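{- The algorithm $\mathrm{IsAttractor}(w,P)$, which decides whether a set $P$ of positions on a word $w$ is a word attractor of $w$, can be implemented to run in time linear in $|w|$, i.e. $O(|w|)$, if the suffix automaton of $w$ is available.
   Context: Let $w=w_1w_2\cdots w_n$ be a finite word over a finite alphabet, $|w|=n$. Positions on $w$ are the elements of $\{1,\dots,n\}$, and a set of positions is a subset $P\subseteq\{1,\dots,n\}$. A factor of $w$ is a word $w_{[i,j]}=w_i\cdots w_j$ (the empty word if $j<i$). An occurrence of a non-empty factor $u$ in $w$ is a pair $(i,j)$, $1\le i\le j\le n$, with $u=w_{[i,j]}$; $j$ is its ending position. A non-empty factor $u$ covers $P$ if there is an occurrence $(i,j)$ of $u$ in $w$ and $t\in P$ with $i\le t\le j$. $P$ is a word attractor of $w$ if every non-empty factor of $w$ covers $P$. Suffix automaton (DAWG): the states of $\mathcal{S}(w)$ are the equivalence classes of the factors of $w$ (including the empty word), where two factors are equivalent iff they have the same set of ending positions in $w$ (the empty word having ending positions $0,1,\dots,n$). The initial state $I$ is the class of the empty word. For a factor $u$, $\delta(I,u)$ is the class of $u$. For a state $q$, $\ell[q]$ is the minimum length of the factors in $q$. Suffix links: for a state $q\neq I$ and any factor $x\in q$, $F[q]$ is the class of the longest suffix of $x$ that does not belong to $q$ (independent of the choice of $x$). The map $F$, viewed as a parent map, makes the set of states a tree $\mathcal{T}$ rooted at $I$. The table of prefix states is $T[j]=\delta(I,w_{[1,j]})$ for $1\le j\le n$. "The suffix automaton is available" means that $\mathcal{S}(w)$ together with its attributes (the tables $F$,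 $\ell$, $T$ and the tree $\mathcal{T}$) has already been computed and is not counted in the running time. Time is counted in the usual unit-cost RAM model (elementary operations on states, positions and integers, and table accesses, each cost $O(1)$); the implied constant does not depend on the alphabet size. Algorithm $\mathrm{IsAttractor}(w,P)$: 1. For each state $q$ of $\mathcal{S}(w)$ set $d[q]\leftarrow+\infty$. 2. Set $k\leftarrow-\infty$. For $j=1,2,\dots,|w|$ in this order: if $j\in P$ then set $k\leftarrow j$; then set $d[T[j]]\leftarrow j-k$ (which is $+\infty$ if $k=-\infty$). 3. For each node $q\neq I$ in a bottom-up traversal of $\mathcal{T}$ (children before parents): set $d[q]\leftarrow\min(\{d[q]\}\cup\{d[r]\mid F[r]=q\})$; if $d[q]\ge\ell[q]$, return $\mathrm{False}$ (and stop). 4. Return $\mathrm{True}$. -}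

module Defs where

open import Data.Bool.Base using (Bool; true; false; if_then_else_)
open import Data.Fin.Base using (Fin; toℕ)
open import Data.Fin.Subset using (Subset; _∈_)
open import Data.List.Base
  using (List; []; _∷_; _++_; length; take; drop; map; foldr; foldl; allFin; lookup)
import Data.List.Membership.Propositional as List
open import Data.List.Relation.Binary.Suffix.Heterogeneous using (Suffix)
open import Data.List.Relation.Unary.Unique.Propositional using (Unique)
open import Data.Nat.Base
  using (ℕ; zero; suc; pred; _+_; _∸_; _⊓_; _≤_; _<_; _≡ᵇ_; _<ᵇ_; _≤ᵇ_; z≤n; s≤s)
open import Data.Product.Base using (Σ-syntax; ∃; ∃-syntax; _×_; _,_; proj₁; proj₂)
import Data.Vec.Base as Vec
open import Data.Vec.Functional using (Vector; updateAt)
open import Function.Base using (const)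
open import Function.Bundles using (_⇔_)
open import Function.Definitions using (StrictlySurjective)
open import Relation.Binary.PropositionalEquality using (_≡_; _≢_; refl)
open import Relation.Nullary.Construct.Add.Infimum using (_₋; ⊥₋)
open import Relation.Nullary.Construct.Add.Supremum using (_⁺; ⊤⁺; [_])

-- Positions on a word are 1, …, |w|; the element k of Fin n stands for
-- position k + 1.
index : ∀ {n} → Fin n → ℕ
index k = suc (toℕ k)

bit : Bool → ℕ
bit true  = 1
bit false = 0

module _ {σ : ℕ} where

  Word : Set
  Word = List (Fin σ)

  -- Meant for 1 ≤ i and j ≤ |w|; it is the empty word if j < i.
  _⟦_,_⟧ : Word → ℕ → ℕ → Word
  w ⟦ i , j ⟧ = take (suc j ∸ i) (drop (pred i) w)

  IsFactor : Word → Word → Set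
  IsFactor w u = ∃[ i ] ∃[ j ] (1 ≤ i × j ≤ length w × u ≡ w ⟦ i , j ⟧)

  Occurrence : Word → Word → ℕ → ℕ → Set
  Occurrence w u i j = 1 ≤ i × i ≤ j × j ≤ length w × u ≡ w ⟦ i , j ⟧

  EndsAt : Word → Word → ℕ → Set
  EndsAt w []        j = j ≤ length w
  EndsAt w u@(_ ∷ _) j = ∃[ i ] Occurrence w u i j

  Covers : (w : Word) → Subset (length w) → Word → Set
  Covers w P u =
    ∃[ i ] ∃[ j ] ∃[ t ]
      (Occurrence w u i j × t ∈ P × i ≤ index t × index t ≤ j)

  WordAttractor : (w : Word) → Subset (length w) → Set
  WordAttractor w P = ∀ u → u ≢ [] → IsFactor w u → Covers w P u

  Factor : Word → Set
  Factor w = ∃[ u ] IsFactor w u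

  emptyFactor : (w : Word) → Factor w
  emptyFactor w = [] , 1 , 0 , s≤s z≤n , z≤n , refl

  SameEnds : (w : Word) → Factor w → Factor w → Set
  SameEnds w (u , _) (v , _) = ∀ j → EndsAt w u j ⇔ EndsAt w v j

-- The set of states is the quotient of the factors of w by SameEnds, presented
-- by a numbering of the classes: δI maps a factor u to its class δ(I,u).

  record SuffixAutomaton (w : Word) : Set where
    field
      size : ℕ

    State : Set
    State = Fin size

    field
      δI            : Factor w → State
      δI-surjective : StrictlySurjective _≡_ δI
      δI-quotient   : ∀ x y → (δI x ≡ δI y) ⇔ SameEnds w x y

    I : State
    I = δI (emptyFactor w)

    IsLongestSuffixOutside : State → Factor w → Factor w → Set
    IsLongestSuffixOutside q x y =
      Suffix _≡_ (proj₁ y) (proj₁ x) × δI y ≢ q ×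
      (∀ z → Suffix _≡_ (proj₁ z) (proj₁ x) → δI z ≢ q →
        length (proj₁ z) ≤ length (proj₁ y))

    field
      ℓ          : State → ℕ
      ℓ-attained : ∀ q → ∃[ x ] (δI x ≡ q × length (proj₁ x) ≡ ℓ q)
      ℓ-minimal  : ∀ x → ℓ (δI x) ≤ length (proj₁ x)

      -- F I is meaningless and never used.
      F      : State → State
      F-link : ∀ q → q ≢ I → ∀ x → δI x ≡ q →
               ∀ y → IsLongestSuffixOutside q x y → F q ≡ δI y

      T        : Fin (length w) → State
      T-prefix : ∀ k (f : IsFactor w (w ⟦ 1 , index k ⟧)) →
                 T k ≡ δI (w ⟦ 1 , index k ⟧ , f)

      -- The tree of suffix links; the children of a node are in any order.
      children        : State → List State
      children-unique : ∀ q → Unique (children q)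
      children-links  : ∀ q r → (r List.∈ children q) ⇔ (r ≢ I × F r ≡ q)

_⊓⁺_ : ℕ ⁺ → ℕ ⁺ → ℕ ⁺
⊤⁺    ⊓⁺ y     = y
[ m ] ⊓⁺ ⊤⁺    = [ m ]
[ m ] ⊓⁺ [ n ] = [ m ⊓ n ]

_≥⁺_ : ℕ ⁺ → ℕ → Bool
⊤⁺    ≥⁺ l = true
[ m ] ≥⁺ l = l ≤ᵇ m

-- j - k, where k is -∞ or a position not exceeding j
_⊝_ : ℕ → ℕ ₋ → ℕ ⁺
j ⊝ ⊥₋    = ⊤⁺
j ⊝ [ k ] = [ j ∸ k ]

module _ {σ : ℕ} {w : Word {σ}} (S : SuffixAutomaton w) where
  open SuffixAutomaton S

  Table : Set
  Table = Vector (ℕ ⁺) size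

  record BottomUp (order : List State) : Set where
    field
      unique       : Unique order
      nodes        : ∀ q → (q List.∈ order) ⇔ (q ≢ I)
      childrenDone : ∀ before q after → order ≡ before ++ q ∷ after →
                     ∀ r → r List.∈ children q → r List.∈ before

  step1 : Table
  step1 _ = ⊤⁺

  step2 : Subset (length w) → Table → Table
  step2 P d₀ = proj₁ (foldl visit (d₀ , ⊥₋) (allFin (length w)))
    where
    visit : Table × ℕ ₋ → Fin (length w) → Table × ℕ ₋
    visit (d , k) j =
      let k′ = if Vec.lookup P j then [ index j ] else k
      in  updateAt d (T j) (const (index j ⊝ k′)) , k′

  step3 : List State → Table → Bool × Table
  step3 []          d = true , d
  step3 (q ∷ order) d =
    let v  = foldr _⊓⁺_ (d q) (map d (children q))
        d′ = updateAt d q (const v)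
    in  if v ≥⁺ ℓ q then (false , d′) else step3 order d′

  -- The answer, together with the table d at the time of returning.
  isAttractor : Subset (length w) → List State → Bool × Table
  isAttractor P order = step3 order (step2 P step1)

-- A unit-cost random access machine: programs over registers and tables of
-- natural numbers.  Every literal, register access, table access, arithmetic
-- operation, comparison, assignment and test costs 1.

Reg Tab : Set
Reg = ℕ
Tab = ℕ

infixl 6 _⊕_ _⊖_
infix  4 _≺_ _≐_
infix  3 _≔_ _⟨_⟩≔_
infixr 2 _⨾_

data Expr : Set where
  lit  : ℕ → Expr
  reg  : Reg → Expr
  _⟨_⟩ : Tab → Expr → Expr
  _⊕_ _⊖_ _≺_ _≐_ : Expr → Expr → Expr

data Cmd : Set where
  skip          : Cmd
  _≔_           : Reg → Expr → Cmd
  _⟨_⟩≔_        : Tab → Expr → Expr → Cmd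
  _⨾_           : Cmd → Cmd → Cmd
  test_then_else_ : Expr → Cmd → Cmd → Cmd
  while_loop_   : Expr → Cmd → Cmd

record Memory : Set where
  constructor ⟪_,_⟫
  field
    regs : Reg → ℕ
    tabs : Tab → ℕ → ℕ

open Memory public

_[_↦_] : ∀ {A : Set} → (ℕ → A) → ℕ → A → (ℕ → A)
(f [ x ↦ v ]) y = if y ≡ᵇ x then v else f y

eval : Expr → Memory → ℕ
eval (lit m)   s = m
eval (reg x)   s = regs s x
eval (a ⟨ e ⟩) s = tabs s a (eval e s)
eval (e ⊕ f)   s = eval e s + eval f s
eval (e ⊖ f)   s = eval e s ∸ eval f s
eval (e ≺ f)   s = bit (eval e s <ᵇ eval f s)
eval (e ≐ f)   s = bit (eval e s ≡ᵇ eval f s)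

cost : Expr → ℕ
cost (lit _)   = 1
cost (reg _)   = 1
cost (_ ⟨ e ⟩) = 1 + cost e
cost (e ⊕ f)   = 1 + cost e + cost f
cost (e ⊖ f)   = 1 + cost e + cost f
cost (e ≺ f)   = 1 + cost e + cost f
cost (e ≐ f)   = 1 + cost e + cost f

-- ⟨ c , s ⟩⇓[ t ] s′: started in memory s, the program c halts after time t
-- in memory s′.  In tests 0 is false and every other number is true.
data ⟨_,_⟩⇓[_]_ : Cmd → Memory → ℕ → Memory → Set where

  ⇓skip  : ∀ {s} → ⟨ skip , s ⟩⇓[ 1 ] s

  ⇓reg   : ∀ {x e s} →
           ⟨ x ≔ e , s ⟩⇓[ 1 + cost e ] ⟪ regs s [ x ↦ eval e s ] , tabs s ⟫

  ⇓tab   : ∀ {a e f s} →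
           ⟨ a ⟨ e ⟩≔ f , s ⟩⇓[ 1 + cost e + cost f ]
             ⟪ regs s , tabs s [ a ↦ tabs s a [ eval e s ↦ eval f s ] ] ⟫

  ⇓seq   : ∀ {c c′ s s′ s″ t t′} →
           ⟨ c , s ⟩⇓[ t ] s′ → ⟨ c′ , s′ ⟩⇓[ t′ ] s″ →
           ⟨ c ⨾ c′ , s ⟩⇓[ t + t′ ] s″

  ⇓then  : ∀ {e c c′ s s′ t} → eval e s ≢ 0 → ⟨ c , s ⟩⇓[ t ] s′ →
           ⟨ test e then c else c′ , s ⟩⇓[ 1 + cost e + t ] s′

  ⇓else  : ∀ {e c c′ s s′ t} → eval e s ≡ 0 → ⟨ c′ , s ⟩⇓[ t ] s′ →
           ⟨ test e then c else c′ , s ⟩⇓[ 1 + cost e + t ] s′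

  ⇓stop  : ∀ {e c s} → eval e s ≡ 0 →
           ⟨ while e loop c , s ⟩⇓[ 1 + cost e ] s

  ⇓again : ∀ {e c s s′ s″ t t′} → eval e s ≢ 0 →
           ⟨ c , s ⟩⇓[ t ] s′ → ⟨ while e loop c , s′ ⟩⇓[ t′ ] s″ →
           ⟨ while e loop c , s ⟩⇓[ 1 + cost e + t + t′ ] s″

lengthᴿ sizeᴿ rootᴿ answerᴿ : Reg
lengthᴿ = 0
sizeᴿ   = 1
rootᴿ   = 2
answerᴿ = 3

wᵀ Pᵀ Fᵀ ℓᵀ Tᵀ firstChildᵀ nextSiblingᵀ dᵀ : Tab
wᵀ           = 0
Pᵀ           = 1
Fᵀ           = 2
ℓᵀ           = 3
Tᵀ           = 4
firstChildᵀ  = 5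
nextSiblingᵀ = 6
dᵀ           = 7

-- LinkedList next p qs: following the pointers next from p lists qs; the
-- pointer 0 marks the end, as states are numbered from 1 in memory.
data LinkedList {n : ℕ} (next : ℕ → ℕ) : ℕ → List (Fin n) → Set where
  end  : LinkedList next 0 []
  node : ∀ {q qs} → LinkedList next (next (index q)) qs →
         LinkedList next (index q) (q ∷ qs)

module _ {σ : ℕ} {w : Word {σ}} (S : SuffixAutomaton w) where
  open SuffixAutomaton S

  -- The memory holds w, P and the precomputed suffix automaton; P is given by
  -- its characteristic table.  All the rest of the memory is arbitrary.
  record Input (P : Subset (length w)) (s : Memory) : Set where
    field
      lengthIn   : regs s lengthᴿ ≡ length w
      sizeIn     : regs s sizeᴿ ≡ size
      rootIn     : regs s rootᴿ ≡ index I
      wordIn     : ∀ k → tabs s wᵀ (index k) ≡ toℕ (lookup w k)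
      PIn        : ∀ k → tabs s Pᵀ (index k) ≡ bit (Vec.lookup P k)
      FIn        : ∀ q → q ≢ I → tabs s Fᵀ (index q) ≡ index (F q)
      ℓIn        : ∀ q → tabs s ℓᵀ (index q) ≡ ℓ q
      TIn        : ∀ k → tabs s Tᵀ (index k) ≡ index (T k)
      childrenIn : ∀ q → LinkedList (tabs s nextSiblingᵀ)
                           (tabs s firstChildᵀ (index q)) (children q)

  -- +∞ may be stored as any number greater than |w|; the finite entries of d
  -- are differences of positions.
  Stores : ℕ ⁺ → ℕ → Set
  Stores [ m ] v = v ≡ m
  Stores ⊤⁺    v = length w < v

  record Output (result : Bool × Table S) (s : Memory) : Set where
    field
      answerOut : regs s answerᴿ ≡ bit (proj₁ result)
      dOut      : ∀ q → Stores (proj₂ result q) (tabs s dᵀ (index q))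

{-# OPTIONS --safe #-}

-- The word u ends at position j iff u is a suffix of the prefix of length j.
-- Hence a position is an ending position of a state q iff its prefix state is q
-- or it is an ending position of a child of q, and after q has been processed
-- d[q] is the least distance from an ending position of q back to the last
-- position of P at or before it.  So d[q] < ℓ[q] iff the shortest word of q covers P,
-- and then so do the longer words of q, which have the same ends.
--
-- A state that is neither the root nor a prefix state has at least two children,
-- whence there are at most 2 |w| + 2 states.  Since ℓ increases strictly from
-- parent to child, sorting the states by decreasing ℓ ≤ |w| into buckets is a
-- bottom-up traversal, computed in linear time.
module Submission where

open import Defs
open import Data.Bool.Base using (Bool; true; false; if_then_else_)
import Data.Bool.Base as Bool
open import Data.Empty using (⊥)
open import Data.Fin.Base using (Fin; toℕ; fromℕ<)
import Data.Fin.Properties as Fin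
open import Data.Fin.Subset using (Subset) renaming (_∈_ to _∈ₛ_)
open import Data.List.Base
  using (List; []; _∷_; _++_; length; take; drop; map; foldl; foldr; filter; lookup;
         tabulate; allFin; concatMap)
open import Data.List.Membership.DecPropositional using () renaming (_∈?_ to memberOf)
open import Data.List.Membership.Propositional using (_∈_; _∉_; find)
import Data.List.Membership.Propositional.Properties as Mem
import Data.List.Membership.Setoid.Properties as SetoidMem
open import Data.List.Properties
  using (length-++; length-map; length-take; length-drop; length-tabulate; take-drop; ++-assoc;
         map-++; filter-accept; filter-reject)
open import Data.List.Relation.Binary.Pointwise using ([]; Pointwise-≡⇒≡; ≡⇒Pointwise-≡)
open import Data.List.Relation.Binary.Suffix.Heterogeneous using (Suffix; here; there)
import Data.List.Relation.Binary.Suffix.Heterogeneous.Properties as Suffix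
open import Data.List.Relation.Unary.All as All using (All; []; _∷_)
import Data.List.Relation.Unary.All.Properties as All
open import Data.List.Relation.Unary.AllPairs as AllPairs using (AllPairs; []; _∷_)
import Data.List.Relation.Unary.AllPairs.Properties as AllPairs
open import Data.List.Relation.Unary.Any as Any using (Any; here; there)
import Data.List.Relation.Unary.Any.Properties as Any
open import Data.List.Relation.Unary.Unique.Propositional using (Unique)
import Data.List.Relation.Unary.Unique.Propositional.Properties as Unique
open import Data.Nat.Base
  using (ℕ; zero; suc; pred; _+_; _*_; _∸_; _⊓_; _≤_; _<_; _≡ᵇ_; _<ᵇ_; _≤ᵇ_; z≤n; s≤s)
open import Data.Nat.ListAction using (sum)
open import Data.Nat.ListAction.Properties using (sum-++)
open import Data.Nat.Properties
open import Data.Nat.Tactic.RingSolver using (solve-∀)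
open import Data.Product.Base using (∃-syntax; _×_; _,_; proj₁; proj₂)
open import Data.Sum.Base using (_⊎_; inj₁; inj₂)
import Data.Vec.Base as Vec
open import Data.Vec.Functional using (updateAt)
import Data.Vec.Functional.Properties as Vector
import Data.Vec.Properties as Vec
open import Function.Base using (_∘_; const; case_of_)
open import Function.Bundles using (_⇔_; mk⇔; Equivalence)
open import Relation.Binary.PropositionalEquality
open import Relation.Nullary using (¬_; yes; no; contradiction)
open import Relation.Nullary.Construct.Add.Infimum using (_₋; ⊥₋)
open import Relation.Nullary.Construct.Add.Supremum using (_⁺; ⊤⁺; [_])
open import Relation.Unary using (Decidable)

open Equivalence using (to; from)

-- Ending positions and suffix links

-- The automaton is given only by its specification: `F` is known at a state once a longest suffix
-- outside that state has been exhibited, and two factors share a state only through their ends.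
-- Facts about the tree are therefore drawn from explicit suffixes, lengthened or shortened letter
-- by letter. No minimum over a set of distances is ever formed. An entry of d is described by the
-- thresholds below which it lies, so that taking a minimum becomes a disjunction and the recursion
-- along the tree becomes an equivalence. Correctness is proved for every bottom-up order. The
-- program produces one of its own and is shown to reproduce `isAttractor` on it, early return and
-- final table included. The link is delicate at +∞, which memory holds as a number above |w|:
-- comparisons come out right because finite entries and all values of `ℓ` are at most |w|.

position : ∀ {n m} → m < n → ∃[ k ] (index {n} k ≡ suc m)
position m<n = fromℕ< m<n , cong suc (Fin.toℕ-fromℕ< m<n)

module _ {A : Set} where

  infix 4 _⊑_

  _⊑_ : List A → List A → Set
  _⊑_ = Suffix _≡_

  ⊑-refl : ∀ {u} → u ⊑ u
  ⊑-refl = here (≡⇒Pointwise-≡ refl)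

  ⊑-trans : ∀ {u v x} → u ⊑ v → v ⊑ x → u ⊑ x
  ⊑-trans = Suffix.trans trans

  []⊑ : ∀ u → [] ⊑ u
  []⊑ []      = here []
  []⊑ (_ ∷ u) = there ([]⊑ u)

  drop-⊑ : ∀ m u → drop m u ⊑ u
  drop-⊑ zero    u       = ⊑-refl
  drop-⊑ (suc m) []      = ⊑-refl
  drop-⊑ (suc m) (_ ∷ u) = there (drop-⊑ m u)

  ⊑-drop : ∀ {u v} → u ⊑ v → u ≡ drop (length v ∸ length u) v
  ⊑-drop {u} {v} (here eqs) with refl ← Pointwise-≡⇒≡ eqs =
    cong (λ m → drop m v) (sym (n∸n≡0 (length v)))
  ⊑-drop {u} {b ∷ v} (there p) =
    trans (⊑-drop p)
          (cong (λ m → drop m (b ∷ v)) (sym (+-∸-assoc 1 (Suffix.length-mono p))))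

module _ {σ : ℕ} (w : Word {σ}) where

  length-prefix : ∀ {j} → j ≤ length w → length (take j w) ≡ j
  length-prefix {j} j≤n = trans (length-take j w) (m≤n⇒m⊓n≡m j≤n)

  ⟦⟧-drop : ∀ {i j} → i ≤ j → w ⟦ suc i , j ⟧ ≡ drop i (take j w)
  ⟦⟧-drop {i} {j} i≤j =
    trans (take-drop (j ∸ i) i w) (cong (λ m → drop i (take m w)) (m+[n∸m]≡n i≤j))

  ⊑-occurrence : ∀ {u j} → j ≤ length w → u ⊑ take j w →
                 u ≡ w ⟦ suc (j ∸ length u) , j ⟧
  ⊑-occurrence {u} {j} j≤n p = begin
    u                                               ≡⟨ ⊑-drop p ⟩
    drop (length (take j w) ∸ length u) (take j w)  ≡⟨ cong (λ m → drop (m ∸ length u) (take j w))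
                                                            (length-prefix j≤n) ⟩
    drop (j ∸ length u) (take j w)                  ≡⟨ ⟦⟧-drop (m∸n≤m j (length u)) ⟨
    w ⟦ suc (j ∸ length u) , j ⟧                    ∎
    where open ≡-Reasoning

  ⊑-length : ∀ {u : Word} {j} → j ≤ length w → u ⊑ take j w → length u ≤ j
  ⊑-length {u} j≤n p = subst (length u ≤_) (length-prefix j≤n) (Suffix.length-mono p)

  occurrence-⊑ : ∀ {u i j} → Occurrence w u i j → u ⊑ take j w
  occurrence-⊑ {i = suc i} {j} (_ , i<j , _ , refl) =
    subst (_⊑ take j w) (sym (⟦⟧-drop (<⇒≤ i<j))) (drop-⊑ i (take j w))

  occurrence-length : ∀ {u i j} → Occurrence w u (suc i) j → length u ≡ j ∸ i
  occurrence-length {i = i} {j} (_ , i<j , j≤n , refl) = begin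
    length (w ⟦ suc i , j ⟧)    ≡⟨ cong length (⟦⟧-drop (<⇒≤ i<j)) ⟩
    length (drop i (take j w))  ≡⟨ length-drop i (take j w) ⟩
    length (take j w) ∸ i       ≡⟨ cong (_∸ i) (length-prefix j≤n) ⟩
    j ∸ i                       ∎
    where open ≡-Reasoning

  endsAt-⊑ : ∀ u {j} → EndsAt w u j → j ≤ length w × u ⊑ take j w
  endsAt-⊑ []      j≤n                         = j≤n , []⊑ _
  endsAt-⊑ (_ ∷ _) (_ , o@(_ , _ , j≤n , _)) = j≤n , occurrence-⊑ o

  ⊑-endsAt : ∀ u {j} → j ≤ length w → u ⊑ take j w → EndsAt w u j
  ⊑-endsAt []          j≤n p = j≤n
  ⊑-endsAt u@(_ ∷ _) {j} j≤n p =
    suc (j ∸ length u) , s≤s z≤n , m∸n<j , j≤n , ⊑-occurrence j≤n p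
    where
    m∸n<j : suc (j ∸ length u) ≤ j
    m∸n<j = subst (_≤ j) (+-∸-assoc 1 (⊑-length j≤n p)) (m∸n≤m j (pred (length u)))

  ⊑-factor : ∀ {u j} → j ≤ length w → u ⊑ take j w → IsFactor w u
  ⊑-factor {u} {j} j≤n p = suc (j ∸ length u) , j , s≤s z≤n , j≤n , ⊑-occurrence j≤n p

  factor-⊑ : ∀ {u} → IsFactor w u → ∃[ j ] (j ≤ length w × u ⊑ take j w)
  factor-⊑ (suc i , j , _ , j≤n , refl) with ≤-total i j
  ... | inj₁ i≤j = j , j≤n , subst (_⊑ take j w) (sym (⟦⟧-drop i≤j)) (drop-⊑ i (take j w))
  ... | inj₂ j≤i rewrite m≤n⇒m∸n≡0 j≤i = j , j≤n , []⊑ _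

  suffix-factor : ∀ {u v} → v ⊑ u → IsFactor w u → IsFactor w v
  suffix-factor p f with j , j≤n , q ← factor-⊑ f = ⊑-factor j≤n (⊑-trans p q)

  tail-factor : ∀ {a u} → IsFactor w (a ∷ u) → IsFactor w u
  tail-factor = suffix-factor (there ⊑-refl)

  nonempty-factor-end : ∀ {u} → u ≢ [] → IsFactor w u → ∃[ k ] u ⊑ take (index {length w} k) w
  nonempty-factor-end u≢[] f with factor-⊑ f
  ... | zero  , _   , here eqs = contradiction (Pointwise-≡⇒≡ eqs) u≢[]
  ... | suc j , j<n , p with k , refl ← position j<n = k , p

  prefixFactor : Fin (length w) → Factor w
  prefixFactor k = w ⟦ 1 , index k ⟧ , 1 , index k , s≤s z≤n , Fin.toℕ<n k , refl

module _ {σ : ℕ} {w : Word {σ}} (S : SuffixAutomaton w) where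
  open SuffixAutomaton S

  δI-cong : ∀ {x y} → proj₁ x ≡ proj₁ y → δI x ≡ δI y
  δI-cong {x} {y} refl = from (δI-quotient x y) (λ _ → mk⇔ (λ e → e) (λ e → e))

  sameEnds : ∀ {x y j} → δI x ≡ δI y → j ≤ length w → proj₁ x ⊑ take j w → proj₁ y ⊑ take j w
  sameEnds {x} {y} eq j≤n p =
    proj₂ (endsAt-⊑ w _ (to (to (δI-quotient x y) eq _) (⊑-endsAt w _ j≤n p)))

  -- Position 0 is an end of the empty word and of no other word.
  δI≡I⇒empty : ∀ x → δI x ≡ I → proj₁ x ≡ []
  δI≡I⇒empty x eq with sameEnds {emptyFactor w} {x} (sym eq) z≤n ([]⊑ _)
  ... | here eqs = Pointwise-≡⇒≡ eqs

  nonempty⇒δI≢I : ∀ x → proj₁ x ≢ [] → δI x ≢ I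
  nonempty⇒δI≢I x u≢[] eq = u≢[] (δI≡I⇒empty x eq)

  δI≢I⇒nonempty : ∀ x → δI x ≢ I → proj₁ x ≢ []
  δI≢I⇒nonempty x ne eq = ne (δI-cong {x} {emptyFactor w} eq)

  -- Position 0 is left out. Only the empty word ends there, so the remaining ends still determine
  -- every state other than the root, as `hasEnd-extensional` shows.
  HasEnd : State → Fin (length w) → Set
  HasEnd q k = ∃[ x ] (δI x ≡ q × proj₁ x ⊑ take (index k) w)

  hasEnd-all : ∀ {q k} → HasEnd q k → ∀ x → δI x ≡ q → proj₁ x ⊑ take (index k) w
  hasEnd-all {k = k} (y , y∈q , p) x x∈q = sameEnds {y} {x} (trans y∈q (sym x∈q)) (Fin.toℕ<n k) p

  T-hasEnd : ∀ k → HasEnd (T k) k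
  T-hasEnd k = prefixFactor w k , sym (T-prefix k _) , ⊑-refl

  -- Prefixes with the same ends are suffixes of each other, hence equally long. Consequently step 2
  -- writes no entry of d twice.
  T-injective : ∀ {k k′} → T k ≡ T k′ → k ≡ k′
  T-injective {k} {k′} eq = Fin.toℕ-injective (suc-injective (≤-antisym (leq k k′ eq) (leq k′ k (sym eq))))
    where
    leq : ∀ k k′ → T k ≡ T k′ → index k ≤ index k′
    leq k k′ eq = subst (_≤ index k′) (length-prefix w (Fin.toℕ<n k))
      (⊑-length w (Fin.toℕ<n k′)
        (hasEnd-all (T-hasEnd k′) (prefixFactor w k) (trans (sym (T-prefix k _)) eq)))

  -- Lengthening a member v of q inside u one letter at a time, either u itself is
  -- reached within q, or some letter leads out of q, to a child of q.
  leave : ∀ {q u v} (fu : IsFactor w u) (fv : IsFactor w v) → v ⊑ u → δI (v , fv) ≡ q →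
          δI (u , fu) ≡ q ⊎
          ∃[ y ] ∃[ a ] ∃[ z ] (proj₁ y ≡ a ∷ proj₁ z × proj₁ y ⊑ u × δI z ≡ q × δI y ≢ q)
  leave fu fv (here eqs) v∈q = inj₁ (trans (δI-cong (sym (Pointwise-≡⇒≡ eqs))) v∈q)
  leave {q} {b ∷ u} fu fv (there p) v∈q
    with fu′ ← tail-factor w fu
    with leave fu′ fv p v∈q
  ... | inj₂ (y , a , z , eq , y⊑u , z∈q , y∉q) = inj₂ (y , a , z , eq , there y⊑u , z∈q , y∉q)
  ... | inj₁ u∈q with δI (b ∷ u , fu) Fin.≟ q
  ...   | yes x∈q = inj₁ x∈q
  ...   | no  x∉q = inj₂ ((b ∷ u , fu) , b , (u , fu′) , refl , ⊑-refl , u∈q , x∉q)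

  -- Every proper suffix of `y` is a suffix of `z`, so `z` is the longest suffix outside the state
  -- of `y` as soon as it lies outside at all.
  link-tail : ∀ {q a} (y z : Factor w) → proj₁ y ≡ a ∷ proj₁ z → δI z ≡ q → δI y ≢ q → F (δI y) ≡ q
  link-tail {q} {a} y z y≡az z∈q y∉q =
    trans (F-link (δI y) (nonempty⇒δI≢I y y≢[]) y refl z (z⊑y , z∉y , longest)) z∈q
    where
    y≢[] : proj₁ y ≢ []
    y≢[] y≡[] with () ← trans (sym y≡az) y≡[]

    z⊑y : proj₁ z ⊑ proj₁ y
    z⊑y = subst (proj₁ z ⊑_) (sym y≡az) (there ⊑-refl)

    z∉y : δI z ≢ δI y
    z∉y eq = y∉q (trans (sym eq) z∈q)

    longest : ∀ v → proj₁ v ⊑ proj₁ y → δI v ≢ δI y → length (proj₁ v) ≤ length (proj₁ z)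
    longest v v⊑y v∉y with subst (proj₁ v ⊑_) y≡az v⊑y
    ... | here eqs = contradiction (δI-cong {v} {y} (trans (Pointwise-≡⇒≡ eqs) (sym y≡az))) v∉y
    ... | there p  = Suffix.length-mono p

  -- A word of q is lengthened towards the whole prefix of length `index k`. Either that prefix is
  -- still in q, or the first word outside q lies in a child and is a suffix of the same prefix. The
  -- conjunct `r ≢ q` is what `branching` contradicts.
  hasEnd-split : ∀ {q k} → HasEnd q k → T k ≡ q ⊎ ∃[ r ] (r ∈ children q × r ≢ q × HasEnd r k)
  hasEnd-split {q} {k} (x , x∈q , p)
    with leave (proj₂ (prefixFactor w k)) (proj₂ x) p x∈q
  ... | inj₁ eq = inj₁ (trans (T-prefix k _) eq)
  ... | inj₂ (y , a , z , y≡az , y⊑ , z∈q , y∉q) =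
    inj₂ (δI y , from (children-links q (δI y)) (nonempty⇒δI≢I y y≢[] , link-tail y z y≡az z∈q y∉q)
         , y∉q , y , refl , y⊑)
    where
    y≢[] : proj₁ y ≢ []
    y≢[] y≡[] with () ← trans (sym y≡az) y≡[]

  -- `F-link` speaks only about a longest suffix already at hand, so one has to be found. Dropping
  -- letters from the left succeeds at the latest at the empty word, which is outside r because r is
  -- not the root.
  longestSuffixOutside : ∀ {r} → r ≢ I → ∀ u (f : IsFactor w u) → δI (u , f) ≡ r →
    ∃[ y ] (IsLongestSuffixOutside r (u , f) y × length (proj₁ y) < length u)
  longestSuffixOutside r≢I [] f u∈r = contradiction (trans (sym u∈r) (δI-cong refl)) r≢I
  longestSuffixOutside {r} r≢I (a ∷ u) f au∈r
    with f′ ← tail-factor w f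
    with δI (u , f′) Fin.≟ r
  ... | no  u∉r = (u , f′) , (there ⊑-refl , u∉r , longest) , ≤-refl
    where
    longest : ∀ v → proj₁ v ⊑ a ∷ u → δI v ≢ r → length (proj₁ v) ≤ length u
    longest v (here eqs) v∉r = contradiction (trans (δI-cong (Pointwise-≡⇒≡ eqs)) au∈r) v∉r
    longest v (there p)  v∉r = Suffix.length-mono p
  ... | yes u∈r with y , (y⊑u , y∉r , longest) , y<u ← longestSuffixOutside r≢I u f′ u∈r =
    y , (there y⊑u , y∉r , longest′) , m≤n⇒m≤1+n y<u
    where
    longest′ : ∀ v → proj₁ v ⊑ a ∷ u → δI v ≢ r → length (proj₁ v) ≤ length (proj₁ y)
    longest′ v (here eqs) v∉r = contradiction (trans (δI-cong (Pointwise-≡⇒≡ eqs)) au∈r) v∉r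
    longest′ v (there p)  v∉r = longest v p v∉r

  hasEnd-parent : ∀ {q r k} → r ∈ children q → HasEnd r k → HasEnd q k
  hasEnd-parent {q} {r} r∈ (x , x∈r , p)
    with r≢I , Fr≡q ← to (children-links q r) r∈
    with y , long@(y⊑x , _) , _ ← longestSuffixOutside r≢I (proj₁ x) (proj₂ x) x∈r =
    y , trans (sym (F-link r r≢I x x∈r y long)) Fr≡q , ⊑-trans y⊑x p

  hasEnd-extensional : ∀ {q r} → q ≢ I → r ≢ I → (∀ {k} → HasEnd q k → HasEnd r k) →
                       (∀ {k} → HasEnd r k → HasEnd q k) → q ≡ r
  hasEnd-extensional {q} {r} q≢I r≢I q⊆r r⊆q
    with x , refl ← δI-surjective q
    with y , refl ← δI-surjective r =
    from (δI-quotient x y) (λ _ → mk⇔ (transfer x y q≢I q⊆r) (transfer y x r≢I r⊆q))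
    where
    transfer : ∀ x y → δI x ≢ I → (∀ {k} → HasEnd (δI x) k → HasEnd (δI y) k) →
               ∀ {j} → EndsAt w (proj₁ x) j → EndsAt w (proj₁ y) j
    transfer x y x≢I x⊆y {j} e with endsAt-⊑ w (proj₁ x) e
    transfer x y x≢I x⊆y {zero}  e | _ , here eqs = contradiction (Pointwise-≡⇒≡ eqs) (δI≢I⇒nonempty x x≢I)
    transfer x y x≢I x⊆y {suc j} e | j<n , p with k , refl ← position j<n =
      ⊑-endsAt w (proj₁ y) j<n (hasEnd-all (x⊆y (x , refl , p)) y refl)

  -- A shortest word of r has its longest suffix outside r in q, and that suffix is strictly
  -- shorter.
  ℓ-parent : ∀ {q r} → r ∈ children q → ℓ q < ℓ r
  ℓ-parent {q} {r} r∈
    with r≢I , Fr≡q ← to (children-links q r) r∈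
    with x , x∈r , ∣x∣ ← ℓ-attained r
    with y , long , y<x ← longestSuffixOutside r≢I (proj₁ x) (proj₂ x) x∈r = begin-strict
      ℓ q               ≡⟨ cong ℓ (trans (sym (F-link r r≢I x x∈r y long)) Fr≡q) ⟨
      ℓ (δI y)          ≤⟨ ℓ-minimal y ⟩
      length (proj₁ y)  <⟨ y<x ⟩
      length (proj₁ x)  ≡⟨ ∣x∣ ⟩
      ℓ r               ∎
    where open ≤-Reasoning

  ℓ-positive : ∀ {q} → q ≢ I → 1 ≤ ℓ q
  ℓ-positive {q} q≢I with ℓ-attained q
  ... | x@([] , _)    , x∈q , _   = contradiction (trans (sym x∈q) (δI-cong {x} {emptyFactor w} refl)) q≢I
  ... | (_ ∷ _ , _) , _   , eq = subst (1 ≤_) eq (s≤s z≤n)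

  ℓ-root : ℓ I ≡ 0
  ℓ-root = n≤0⇒n≡0 (ℓ-minimal (emptyFactor w))

  ℓ-bounded : ∀ q → ℓ q ≤ length w
  ℓ-bounded q with (u , f) , _ , eq ← ℓ-attained q with j , j≤n , p ← factor-⊑ w f =
    subst (_≤ length w) eq (≤-trans (⊑-length w j≤n p) j≤n)

-- The number of states

unique-lookup-injective : ∀ {A : Set} {xs : List A} → Unique xs →
  ∀ {i j} → lookup xs i ≡ lookup xs j → i ≡ j
unique-lookup-injective (_  ∷ _)  {Fin.zero}  {Fin.zero}  _  = refl
unique-lookup-injective (x∉ ∷ _)  {Fin.zero}  {Fin.suc j} eq = contradiction eq (All.lookup x∉ (Mem.∈-lookup j))
unique-lookup-injective (x∉ ∷ _)  {Fin.suc i} {Fin.zero}  eq = contradiction (sym eq) (All.lookup x∉ (Mem.∈-lookup i))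
unique-lookup-injective (_  ∷ xs) {Fin.suc i} {Fin.suc j} eq = cong Fin.suc (unique-lookup-injective xs eq)

unique-length : ∀ {A : Set} {xs ys : List A} → Unique xs → (∀ {x} → x ∈ xs → x ∈ ys) →
                length xs ≤ length ys
unique-length {xs = xs} uniq sub = Fin.injective⇒≤ {f = λ i → Any.index (sub (Mem.∈-lookup i))}
  (λ eq → unique-lookup-injective uniq
    (SetoidMem.index-injective (setoid _) (sub (Mem.∈-lookup _)) (sub (Mem.∈-lookup _)) eq))

unique-Fin-length : ∀ {m} {xs : List (Fin m)} → Unique xs → length xs ≤ m
unique-Fin-length {m} {xs} uniq =
  subst (length xs ≤_) (length-tabulate {n = m} (λ i → i)) (unique-length uniq (λ {x} _ → Mem.∈-allFin x))

-- Each entry needs 2 on the right: its image supplies them when `P` fails, the filtered list when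
-- `P` holds. With children for `f`, the concatenation lists the edges of the tree.
concatMap-length-≥ : ∀ {A B : Set} (f : A → List B) {P : A → Set} (P? : Decidable P) →
  (∀ {x} → ¬ P x → 2 ≤ length (f x)) →
  ∀ xs → 2 * length xs ≤ length (concatMap f xs) + 2 * length (filter P? xs)
concatMap-length-≥ f P? two []       = z≤n
concatMap-length-≥ f P? two (x ∷ xs) with ih ← concatMap-length-≥ f P? two xs | P? x
... | yes _ = begin
  2 * suc (length xs)               ≡⟨ *-suc 2 (length xs) ⟩
  2 + 2 * length xs                 ≤⟨ +-monoʳ-≤ 2 ih ⟩
  2 + (c + 2 * p)                   ≤⟨ m≤n+m _ (length (f x)) ⟩
  length (f x) + (2 + (c + 2 * p))  ≡⟨ rearrange (length (f x)) c p ⟩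
  (length (f x) + c) + 2 * suc p    ≡⟨ cong (_+ 2 * suc p) (length-++ (f x)) ⟨
  length (concatMap f (x ∷ xs)) + 2 * suc p ∎
  where
  open ≤-Reasoning
  c = length (concatMap f xs)
  p = length (filter P? xs)
  rearrange : ∀ d c p → d + (2 + (c + 2 * p)) ≡ (d + c) + 2 * suc p
  rearrange = solve-∀
... | no ¬Px = begin
  2 * suc (length xs)               ≡⟨ *-suc 2 (length xs) ⟩
  2 + 2 * length xs                 ≤⟨ +-mono-≤ (two ¬Px) ih ⟩
  length (f x) + (c + 2 * p)        ≡⟨ +-assoc (length (f x)) c (2 * p) ⟨
  (length (f x) + c) + 2 * p        ≡⟨ cong (_+ 2 * p) (length-++ (f x)) ⟨
  length (concatMap f (x ∷ xs)) + 2 * p ∎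
  where
  open ≤-Reasoning
  c = length (concatMap f xs)
  p = length (filter P? xs)

module _ {σ : ℕ} {w : Word {σ}} (S : SuffixAutomaton w) where
  open SuffixAutomaton S

  -- A node has a single parent `F r`, so different nodes have disjoint lists of children. This
  -- bounds the number of edges by `size`, both in counting the states and in timing step 3.
  concatMap-children-unique : ∀ {qs} → Unique qs → Unique (concatMap children qs)
  concatMap-children-unique {qs} uniq =
    Unique.concat⁺ (All.map⁺ (All.universal children-unique qs))
      (AllPairs.map⁺ (AllPairs.map disjoint uniq))
    where
    disjoint : ∀ {q q′} → q ≢ q′ → ∀ {r} → r ∈ children q × r ∈ children q′ → _
    disjoint {q} {q′} q≢q′ {r} (r∈q , r∈q′) =
      q≢q′ (trans (sym (proj₂ (to (children-links q r) r∈q))) (proj₂ (to (children-links q′ r) r∈q′)))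

  -- The root is among the exceptions to `branching`: if `w` is empty or a power of one letter, it
  -- has at most one child.
  prefixStates : List State
  prefixStates = I ∷ map T (allFin (length w))

  -- If an inner state r were the only child of q, every end of q would be an end
  -- of r, and r would be q.
  branching : ∀ {q} → q ∉ prefixStates → 2 ≤ length (children q)
  branching {q} q∉ with δI-surjective q
  ... | x , refl with nonempty-factor-end w (δI≢I⇒nonempty S x (q∉ ∘ here)) (proj₂ x)
  ... | k , p = atLeastTwo (children q) refl
    where
    split : ∀ {k} → HasEnd S q k → ∃[ r ] (r ∈ children q × r ≢ q × HasEnd S r k)
    split {k} e with hasEnd-split S e
    ... | inj₁ Tk≡q = contradiction (there (subst (_∈ map T _) Tk≡q (Mem.∈-map⁺ T (Mem.∈-allFin k)))) q∉
    ... | inj₂ r    = r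

    atLeastTwo : ∀ rs → children q ≡ rs → 2 ≤ length rs
    atLeastTwo rs eq with split (x , refl , p)
    atLeastTwo []             eq | r , r∈ , _ with () ← subst (r ∈_) eq r∈
    atLeastTwo (_ ∷ _ ∷ _)    eq | _ = s≤s (s≤s z≤n)
    atLeastTwo (r ∷ [])       eq | r′ , r∈ , r≢q , _ with subst (r′ ∈_) eq r∈
    ... | here refl = contradiction r≡q r≢q
      where
      toChild : ∀ {k} → HasEnd S q k → HasEnd S r k
      toChild e with split e
      ... | r″ , r″∈ , _ , e′ with subst (r″ ∈_) eq r″∈
      ... | here refl = e′
      r≡q : r ≡ q
      r≡q = hasEnd-extensional S (proj₁ (to (children-links q r) r∈)) (q∉ ∘ here) (hasEnd-parent S r∈) toChild

  -- Twice the number of states is at most the number of edges plus twice the number of exceptions.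
  -- The edges number at most `size`, which then cancels.
  size-bound : size ≤ 2 * suc (length w)
  size-bound = +-cancelˡ-≤ size _ _ (begin
    size + size  ≡⟨ cong (size +_) (+-identityʳ size) ⟨
    2 * size     ≡⟨ cong (2 *_) (length-tabulate {n = size} (λ i → i)) ⟨
    2 * length (allFin size)  ≤⟨ concatMap-length-≥ children prefix? branching (allFin size) ⟩
    length (concatMap children (allFin size)) + 2 * length prefixes
      ≤⟨ +-mono-≤ (unique-Fin-length (concatMap-children-unique (Unique.allFin⁺ size)))
                  (*-monoʳ-≤ 2 (unique-length (Unique.filter⁺ prefix? (Unique.allFin⁺ size))
                                              (proj₂ ∘ Mem.∈-filter⁻ prefix? {xs = allFin size}))) ⟩
    size + 2 * length prefixStates
      ≡⟨ cong (λ m → size + 2 * suc m) (trans (length-map T (allFin (length w)))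
                                              (length-tabulate {n = length w} (λ i → i))) ⟩
    size + 2 * suc (length w) ∎)
    where
    open ≤-Reasoning
    prefix? = λ q → memberOf Fin._≟_ q prefixStates
    prefixes = filter prefix? (allFin size)

-- Correctness

_<⁺_ : ℕ ⁺ → ℕ → Set
⊤⁺    <⁺ l = ⊥
[ m ] <⁺ l = m < l

⊓⁺-<⁺ : ∀ x y {l} → (x ⊓⁺ y) <⁺ l ⇔ (x <⁺ l ⊎ y <⁺ l)
⊓⁺-<⁺ ⊤⁺    y     = mk⇔ inj₂ λ { (inj₁ ()) ; (inj₂ p) → p }
⊓⁺-<⁺ [ m ] ⊤⁺    = mk⇔ inj₁ λ { (inj₁ p) → p ; (inj₂ ()) }
⊓⁺-<⁺ [ m ] [ n ] = mk⇔ split λ { (inj₁ p) → ≤-<-trans (m⊓n≤m m n) p ; (inj₂ p) → ≤-<-trans (m⊓n≤n m n) p }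
  where
  split : ∀ {l} → m ⊓ n < l → m < l ⊎ n < l
  split p with ⊓-sel m n
  ... | inj₁ eq = inj₁ (subst (_< _) eq p)
  ... | inj₂ eq = inj₂ (subst (_< _) eq p)

foldr-<⁺ : ∀ a xs {l} → foldr _⊓⁺_ a xs <⁺ l ⇔ (a <⁺ l ⊎ Any (_<⁺ l) xs)
foldr-<⁺ a []       = mk⇔ inj₁ λ { (inj₁ p) → p ; (inj₂ ()) }
foldr-<⁺ a (x ∷ xs) = mk⇔
  (λ p → case to (⊓⁺-<⁺ x _) p of λ
    { (inj₁ q) → inj₂ (here q)
    ; (inj₂ q) → case to (foldr-<⁺ a xs) q of λ { (inj₁ r) → inj₁ r ; (inj₂ r) → inj₂ (there r) } })
  λ { (inj₁ p)         → from (⊓⁺-<⁺ x _) (inj₂ (from (foldr-<⁺ a xs) (inj₁ p)))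
    ; (inj₂ (here p))  → from (⊓⁺-<⁺ x _) (inj₁ p)
    ; (inj₂ (there p)) → from (⊓⁺-<⁺ x _) (inj₂ (from (foldr-<⁺ a xs) (inj₂ p))) }

≥⁺-or-<⁺ : ∀ v l → ((v ≥⁺ l) ≡ true × ¬ v <⁺ l) ⊎ ((v ≥⁺ l) ≡ false × v <⁺ l)
≥⁺-or-<⁺ ⊤⁺    l = inj₁ (refl , λ ())
≥⁺-or-<⁺ [ m ] l with l ≤ᵇ m in eq
... | true  = inj₁ (refl , ≤⇒≯ (≤ᵇ⇒≤ l m (subst Bool.T (sym eq) _)))
... | false = inj₂ (refl , ≰⇒> (λ l≤m → subst Bool.T eq (≤⇒≤ᵇ l≤m)))

-- What remains of the positions after the first `i`, ending exactly at the last one: the common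
-- recursion pattern for `foldl` in step 2 and for the loop that executes it.
data Ascending {n} : ℕ → List (Fin n) → Set where
  done : Ascending n []
  step : ∀ {k ks} → Ascending (index k) ks → Ascending (toℕ k) (k ∷ ks)

allFin-ascending : ∀ n → Ascending 0 (allFin n)
allFin-ascending n = go n (λ k → k) 0 (λ _ → refl) refl
  where
  go : ∀ m (f : Fin m → Fin n) i → (∀ k → toℕ (f k) ≡ i + toℕ k) → i + m ≡ n → Ascending i (tabulate f)
  go zero    f i _  eq = subst (λ i → Ascending i []) (trans (sym eq) (+-identityʳ i)) done
  go (suc m) f i f≡ eq = subst (λ i → Ascending i (tabulate f)) f0≡i
    (step (subst (λ i → Ascending i (tabulate (f ∘ Fin.suc))) (cong suc (sym f0≡i))
      (go m (f ∘ Fin.suc) (suc i) (λ k → trans (f≡ (Fin.suc k)) (+-suc i (toℕ k))) (trans (sym (+-suc i m)) eq))))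
    where
    f0≡i : toℕ (f Fin.zero) ≡ i
    f0≡i = trans (f≡ Fin.zero) (+-identityʳ i)

unique-++-∉ : ∀ {A : Set} {xs ys} {x : A} → Unique (xs ++ x ∷ ys) → x ∉ xs
unique-++-∉ {xs = _ ∷ xs} (x∉ ∷ _)   (here refl) = All.lookup x∉ (Mem.∈-++⁺ʳ xs (here refl)) refl
unique-++-∉ {xs = _ ∷ xs} (_ ∷ uniq) (there x∈)  = unique-++-∉ uniq x∈

module _ {n} (P : Subset n) where

  -- An occurrence of length `l` ending at `k` contains `t` exactly under these inequalities; the
  -- sum avoids truncated subtraction.
  Near : Fin n → ℕ → Set
  Near k l = ∃[ t ] (t ∈ₛ P × index t ≤ index k × index k < index t + l)

  Last : ℕ → ℕ ₋ → Set
  Last i ⊥₋    = ∀ t → t ∈ₛ P → ¬ index t ≤ i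
  Last i [ p ] = (∃[ t ] (t ∈ₛ P × index t ≡ p × p ≤ i)) × (∀ t → t ∈ₛ P → index t ≤ i → index t ≤ p)

  latest : Fin n → ℕ ₋ → ℕ ₋
  latest j κ = if Vec.lookup P j then [ index j ] else κ

  earlier : ∀ {j t} → Vec.lookup P j ≡ false → t ∈ₛ P → index t ≤ index j → index t ≤ toℕ j
  earlier j∉P t∈P t≤j = ≤∧≢⇒< (≤-pred t≤j)
    (λ t≡j → case trans (sym j∉P) (Vec.[]=⇒lookup (subst (_∈ₛ P) (Fin.toℕ-injective t≡j) t∈P)) of λ ())

  last-latest : ∀ j {κ} → Last (toℕ j) κ → Last (index j) (latest j κ)
  last-latest j {κ} last with Vec.lookup P j in eq
  ... | true  = (j , Vec.lookup⇒[]= j P eq , refl , ≤-refl) , λ _ _ t≤j → t≤j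
  ... | false with κ | last
  ...   | ⊥₋    | none = λ t t∈P t≤j → none t t∈P (earlier eq t∈P t≤j)
  ...   | [ p ] | ((t , t∈P , t≡p , p≤j) , max) =
    (t , t∈P , t≡p , m≤n⇒m≤1+n p≤j) , λ t t∈P t≤j → max t t∈P (earlier eq t∈P t≤j)

  -- Of all positions of `P` up to `j` the last is the nearest, so some position is within distance
  -- l if and only if the last one is.
  ⊝-near : ∀ j {κ l} → Last (index j) κ → (index j ⊝ κ) <⁺ l ⇔ Near j l
  ⊝-near j {⊥₋}         none = mk⇔ (λ ()) λ (t , t∈P , t≤j , _) → none t t∈P t≤j
  ⊝-near j {[ p ]} {l} ((t , t∈P , refl , t≤j) , max) = mk⇔
    (λ d<l → t , t∈P , t≤j , (begin-strict
      index j                        ≡⟨ m+[n∸m]≡n t≤j ⟨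
      index t + (index j ∸ index t)  <⟨ +-monoʳ-< (index t) d<l ⟩
      index t + l                    ∎))
    λ (t′ , t′∈P , t′≤j , j<t′+l) → +-cancelˡ-< (index t) _ _ (begin-strict
      index t + (index j ∸ index t)  ≡⟨ m+[n∸m]≡n t≤j ⟩
      index j                        <⟨ j<t′+l ⟩
      index t′ + l                   ≤⟨ +-monoˡ-≤ l (max t′ t′∈P t′≤j) ⟩
      index t + l                    ∎)
    where open ≤-Reasoning

module _ {σ : ℕ} {w : Word {σ}} (S : SuffixAutomaton w) (P : Subset (length w)) where
  open SuffixAutomaton S

  -- A named copy of the local function of `step2`, with which it agrees definitionally.
  visit : Table S × ℕ ₋ → Fin (length w) → Table S × ℕ ₋
  visit (d , κ) j = updateAt d (T j) (const (index j ⊝ latest P j κ)) , latest P j κ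

  Marked : ℕ → Table S → Set
  Marked i d = ∀ q l → d q <⁺ l ⇔ (∃[ k ] (index k ≤ i × T k ≡ q × Near P k l))

  visit-marked : ∀ j {d κ} → Marked (toℕ j) d → Last P (toℕ j) κ →
                 Marked (index j) (proj₁ (visit (d , κ) j))
  visit-marked j {d} {κ} marked last q l with q Fin.≟ T j
  ... | yes refl rewrite Vector.updateAt-updates (T j) {const (index j ⊝ latest P j κ)} d = mk⇔
    (λ p → j , ≤-refl , refl , to (⊝-near P j (last-latest P j last)) p)
    λ (k , _ , Tk≡Tj , near) →
      from (⊝-near P j (last-latest P j last)) (subst (λ k → Near P k l) (T-injective S Tk≡Tj) near)
  ... | no q≢Tj rewrite Vector.updateAt-minimal q (T j) {const (index j ⊝ latest P j κ)} d q≢Tj = mk⇔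
    (λ p → let k , k≤j , rest = to (marked q l) p in k , m≤n⇒m≤1+n k≤j , rest)
    λ (k , k≤j , Tk≡q , near) → from (marked q l)
      (k , ≤∧≢⇒< (≤-pred k≤j) (λ eq → q≢Tj (trans (sym Tk≡q) (cong T (Fin.toℕ-injective eq)))) , Tk≡q , near)

  foldl-marked : ∀ {i js} → Ascending i js → ∀ d κ → Marked i d → Last P i κ →
                 Marked (length w) (proj₁ (foldl visit (d , κ) js))
  foldl-marked done           d κ marked _    = marked
  foldl-marked (step {j} asc) d κ marked last =
    foldl-marked asc _ _ (visit-marked j marked last) (last-latest P j last)

  step2-marked : Marked (length w) (step2 S P (step1 S))
  step2-marked = foldl-marked (allFin-ascending _) (step1 S) ⊥₋
    (λ q l → mk⇔ (λ ()) λ { (_ , () , _) }) λ { _ _ () }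

  Reached : State → ℕ → Set
  Reached q l = ∃[ k ] (HasEnd S q k × Near P k l)

  attractor⇔reached : (∀ q → q ≢ I → Reached q (ℓ q)) ⇔ WordAttractor w P
  attractor⇔reached = mk⇔ attractor reached
    where
    attractor : (∀ q → q ≢ I → Reached q (ℓ q)) → WordAttractor w P
    attractor reached u u≢[] f
      with k , ends , t , t∈P , t≤k , k<t+ℓ ← reached (δI (u , f)) (nonempty⇒δI≢I S (u , f) u≢[]) =
      suc (index k ∸ length u) , index k , t
      , (s≤s z≤n , start u u≢[] , Fin.toℕ<n k
         , ⊑-occurrence w (Fin.toℕ<n k) (hasEnd-all S ends (u , f) refl))
      , t∈P , +-cancelʳ-≤ (length u) _ _ covers , t≤k
      where
      u≤k : length u ≤ index k
      u≤k = ⊑-length w (Fin.toℕ<n k) (hasEnd-all S ends (u , f) refl)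

      start : ∀ u → u ≢ [] → suc (index k ∸ length u) ≤ index k
      start []      ne = contradiction refl ne
      start (_ ∷ u) _  = s≤s (m∸n≤m (toℕ k) (length u))

      covers : suc (index k ∸ length u) + length u ≤ index t + length u
      covers = begin
        suc (index k ∸ length u + length u)  ≡⟨ cong suc (m∸n+n≡m u≤k) ⟩
        suc (index k)                        ≤⟨ k<t+ℓ ⟩
        index t + ℓ (δI (u , f))             ≤⟨ +-monoʳ-≤ (index t) (ℓ-minimal (u , f)) ⟩
        index t + length u                   ∎
        where open ≤-Reasoning

    reached : WordAttractor w P → ∀ q → q ≢ I → Reached q (ℓ q)
    reached attr q q≢I
      with (u , f) , refl , ∣u∣≡ℓ ← ℓ-attained q
      with attr u (δI≢I⇒nonempty S (u , f) q≢I) f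
    ... | suc i , suc j , t , o@(_ , s≤s i≤j , j<n , u≡) , t∈P , i≤t , t≤j
      with k , refl ← position {length w} j<n =
      k , ((u , f) , refl , occurrence-⊑ w o) , t , t∈P , t≤j , (begin-strict
        index k                    ≡⟨ m+[n∸m]≡n (m≤n⇒m≤1+n i≤j) ⟨
        i + (index k ∸ i)          <⟨ +-monoˡ-< (index k ∸ i) i≤t ⟩
        index t + (index k ∸ i)    ≡⟨ cong (index t +_) (occurrence-length w o) ⟨
        index t + length u         ≡⟨ cong (index t +_) ∣u∣≡ℓ ⟩
        index t + ℓ (δI (u , f))   ∎)
      where open ≤-Reasoning

  -- Step 3: passing distances up the suffix links

  module _ {order} (bottomUp : BottomUp S order) where
    open BottomUp bottomUp

    d₂ : Table S
    d₂ = step2 S P (step1 S)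

    -- The second half is needed because a visit to q reads `d q` itself, which must still be the
    -- value left by step 2. That q has not been visited earlier follows from the uniqueness of the
    -- order.
    Processed : List State → Table S → Set
    Processed before d = (∀ q → q ∈ before → ∀ l → d q <⁺ l ⇔ Reached q l) ×
                         (∀ q → q ∉ before → d q ≡ d₂ q)

    value : State → Table S → ℕ ⁺
    value q d = foldr _⊓⁺_ (d q) (map d (children q))

    value-reached : ∀ {before q after d} → order ≡ before ++ q ∷ after → q ∉ before →
                    Processed before d → ∀ l → value q d <⁺ l ⇔ Reached q l
    value-reached {before} {q} {after} {d} eq q∉ (old , new) l = mk⇔ up down
      where
      up : value q d <⁺ l → Reached q l
      up p with to (foldr-<⁺ (d q) (map d (children q))) p
      ... | inj₁ dq<l with k , _ , refl , near ← to (step2-marked q l) (subst (_<⁺ l) (new q q∉) dq<l) =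
        k , T-hasEnd S k , near
      ... | inj₂ any with r , r∈ , dr<l ← find (Any.map⁻ any)
                     with k , ends , near ← to (old r (childrenDone before q after eq r r∈) l) dr<l =
        k , hasEnd-parent S r∈ ends , near

      down : Reached q l → value q d <⁺ l
      down (k , ends , near) with hasEnd-split S ends
      ... | inj₁ Tk≡q = from (foldr-<⁺ (d q) (map d (children q)))
        (inj₁ (subst (_<⁺ l) (sym (new q q∉)) (from (step2-marked q l) (k , Fin.toℕ<n k , Tk≡q , near))))
      ... | inj₂ (r , r∈ , _ , ends′) = from (foldr-<⁺ (d q) (map d (children q)))
        (inj₂ (Any.map⁺ (Any.map (λ { refl → from (old r (childrenDone before q after eq r r∈) l) (k , ends′ , near) }) r∈)))

    processed-step : ∀ {before q after d} → order ≡ before ++ q ∷ after → q ∉ before →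
                     Processed before d → Processed (before ++ q ∷ []) (updateAt d q (const (value q d)))
    processed-step {before} {q} {after} {d} eq q∉ inv@(old , new) = old′ , new′
      where
      old′ : ∀ r → r ∈ before ++ q ∷ [] → ∀ l → updateAt d q (const (value q d)) r <⁺ l ⇔ Reached r l
      old′ r r∈ l with Mem.∈-++⁻ before r∈
      ... | inj₂ (here refl) rewrite Vector.updateAt-updates q {const (value q d)} d =
        value-reached eq q∉ inv l
      ... | inj₁ r∈before rewrite Vector.updateAt-minimal r q {const (value q d)} d (λ { refl → q∉ r∈before }) =
        old r r∈before l

      new′ : ∀ r → r ∉ before ++ q ∷ [] → updateAt d q (const (value q d)) r ≡ d₂ r
      new′ r r∉ = trans (Vector.updateAt-minimal r q d (λ { refl → r∉ (Mem.∈-++⁺ʳ before (here refl)) }))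
                        (new r (r∉ ∘ Mem.∈-++⁺ˡ))

    unique-middle : ∀ {before q after} → order ≡ before ++ q ∷ after → q ∉ before
    unique-middle refl = unique-++-∉ unique

    -- The value computed at the visit of q is already exact, so a failed test refutes the
    -- right-hand side at once and the early return is sound.
    step3-reached : ∀ before rest d → order ≡ before ++ rest → Processed before d →
                    (proj₁ (step3 S rest d) ≡ true) ⇔ (∀ q → q ∈ rest → Reached q (ℓ q))
    step3-reached before []         d eq inv = mk⇔ (λ _ _ ()) (λ _ → refl)
    step3-reached before (q ∷ rest) d eq inv with ≥⁺-or-<⁺ (value q d) (ℓ q)
    ... | inj₁ (≥-true , ≮) rewrite ≥-true = mk⇔ (λ ())
      (λ all → contradiction (from (value-reached eq (unique-middle eq) inv (ℓ q)) (all q (here refl))) ≮)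
    ... | inj₂ (≥-false , <) rewrite ≥-false = mk⇔
      (λ t → λ { _ (here refl) → to (value-reached eq q∉ inv (ℓ q)) < ; r (there r∈) → to IH t r r∈ })
      (λ all → from IH (λ r → all r ∘ there))
      where
      q∉ = unique-middle eq
      IH = step3-reached (before ++ q ∷ []) rest _ (trans eq (sym (++-assoc before _ rest)))
             (processed-step eq q∉ inv)

    isAttractor-correct : (proj₁ (isAttractor S P order) ≡ true) ⇔ WordAttractor w P
    isAttractor-correct = mk⇔
      (λ t → to attractor⇔reached (λ q q≢I → to main t q (from (nodes q) q≢I)))
      (λ attr → from main (λ q q∈ → from attractor⇔reached attr q (to (nodes q) q∈)))
      where
      main = step3-reached [] order d₂ refl ((λ _ ()) , λ _ _ → refl)

-- Traversal by decreasing ℓ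

allPairs-∈ : ∀ {A : Set} {R : A → A → Set} xs → (∀ {x y} → x ∈ xs → y ∈ xs → R x y) → AllPairs R xs
allPairs-∈ []       r = []
allPairs-∈ (x ∷ xs) r = All.tabulate (r (here refl) ∘ there) ∷ allPairs-∈ xs (λ x∈ y∈ → r (there x∈) (there y∈))

allPairs-after : ∀ {A : Set} {R : A → A → Set} xs {y ys} → AllPairs R (xs ++ y ∷ ys) → All (R y) ys
allPairs-after []       (rs ∷ _)  = rs
allPairs-after (_ ∷ xs) (_ ∷ rss) = allPairs-after xs rss

module _ {σ : ℕ} {w : Word {σ}} (S : SuffixAutomaton w) where
  open SuffixAutomaton S

  level : ℕ → List State → List State
  level l = filter (λ q → ℓ q ≟ l)

  -- Level 0 is omitted: it holds the root alone, which step 3 does not visit.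
  byLevel : List State → ℕ → List State
  byLevel qs zero    = []
  byLevel qs (suc l) = level (suc l) qs ++ byLevel qs l

  ∈-level⁻ : ∀ {l qs q} → q ∈ level l qs → ℓ q ≡ l
  ∈-level⁻ {l} {qs} = proj₂ ∘ Mem.∈-filter⁻ (λ q → ℓ q ≟ l) {xs = qs}

  ∈-byLevel⁻ : ∀ {qs q} l → q ∈ byLevel qs l → 1 ≤ ℓ q × ℓ q ≤ l
  ∈-byLevel⁻ {qs} (suc l) q∈ with Mem.∈-++⁻ (level (suc l) qs) q∈
  ... | inj₁ q∈ rewrite ∈-level⁻ {suc l} {qs} q∈ = s≤s z≤n , ≤-refl
  ... | inj₂ q∈ with 1≤ , ≤l ← ∈-byLevel⁻ l q∈ = 1≤ , m≤n⇒m≤1+n ≤l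

  ∈-byLevel⁺ : ∀ {qs q} l → q ∈ qs → 1 ≤ ℓ q → ℓ q ≤ l → q ∈ byLevel qs l
  ∈-byLevel⁺ zero    q∈ 1≤ ≤0 = contradiction (≤-trans 1≤ ≤0) λ ()
  ∈-byLevel⁺ {qs} {q} (suc l) q∈ 1≤ ≤1+l with ℓ q ≟ suc l
  ... | yes eq = Mem.∈-++⁺ˡ (Mem.∈-filter⁺ (λ q → ℓ q ≟ suc l) q∈ eq)
  ... | no  ne = Mem.∈-++⁺ʳ (level (suc l) qs) (∈-byLevel⁺ l q∈ 1≤ (≤-pred (≤∧≢⇒< ≤1+l ne)))

  byLevel-unique : ∀ {qs} l → Unique qs → Unique (byLevel qs l)
  byLevel-unique zero    uniq = []
  byLevel-unique {qs} (suc l) uniq = Unique.++⁺ (Unique.filter⁺ _ uniq) (byLevel-unique l uniq)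
    λ (q∈ , q∈′) → <⇒≢ (s≤s (proj₂ (∈-byLevel⁻ l q∈′))) (∈-level⁻ {suc l} {qs} q∈)

  byLevel-sorted : ∀ qs l → AllPairs (λ q r → ℓ r ≤ ℓ q) (byLevel qs l)
  byLevel-sorted qs zero    = []
  byLevel-sorted qs (suc l) = AllPairs.++⁺
    (allPairs-∈ _ λ x∈ y∈ → ≤-reflexive (trans (∈-level⁻ {suc l} {qs} y∈) (sym (∈-level⁻ {suc l} {qs} x∈))))
    (byLevel-sorted qs l)
    (All.tabulate λ x∈ → All.tabulate λ y∈ →
      ≤-trans (m≤n⇒m≤1+n (proj₂ (∈-byLevel⁻ l y∈))) (≤-reflexive (sym (∈-level⁻ {suc l} {qs} x∈))))

  -- A child standing after its parent would have no larger `ℓ`, against `ℓ-parent`. The enumeration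
  -- `qs` is arbitrary, since the order inside a level is irrelevant to this argument.
  byLevel-bottomUp : ∀ {qs} → Unique qs → (∀ q → q ∈ qs) → BottomUp S (byLevel qs (length w))
  byLevel-bottomUp {qs} uniq complete = record
    { unique       = byLevel-unique (length w) uniq
    ; nodes        = λ q → mk⇔
        (λ { q∈ refl → contradiction (subst (1 ≤_) (ℓ-root S) (proj₁ (∈-byLevel⁻ (length w) q∈))) λ () })
        nonRoot∈
    ; childrenDone = childrenDone
    }
    where
    nonRoot∈ : ∀ {q} → q ≢ I → q ∈ byLevel qs (length w)
    nonRoot∈ {q} q≢I = ∈-byLevel⁺ (length w) (complete q) (ℓ-positive S q≢I) (ℓ-bounded S q)

    childrenDone : ∀ before q after → byLevel qs (length w) ≡ before ++ q ∷ after →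
                   ∀ r → r ∈ children q → r ∈ before
    childrenDone before q after eq r r∈
      with Mem.∈-++⁻ before (subst (r ∈_) eq (nonRoot∈ (proj₁ (to (children-links q r) r∈))))
    ... | inj₁ r∈before      = r∈before
    ... | inj₂ (here refl)   = contradiction (ℓ-parent S r∈) (<-irrefl refl)
    ... | inj₂ (there r∈aft) = contradiction (ℓ-parent S r∈)
      (≤⇒≯ (All.lookup (allPairs-after before (subst (AllPairs _) eq (byLevel-sorted qs (length w)))) r∈aft))

-- The program and its running time

≡ᵇ-true : ∀ {m n} → m ≡ n → (m ≡ᵇ n) ≡ true
≡ᵇ-true {m} {n} eq with m ≡ᵇ n | ≡⇒≡ᵇ m n eq
... | true | _ = refl

≡ᵇ-false : ∀ {m n} → m ≢ n → (m ≡ᵇ n) ≡ false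
≡ᵇ-false {m} {n} ne with m ≡ᵇ n | ≡ᵇ⇒≡ m n
... | true  | eq = contradiction (eq _) ne
... | false | _  = refl

↦-hit : ∀ {A : Set} (f : ℕ → A) {x y v} → y ≡ x → (f [ x ↦ v ]) y ≡ v
↦-hit f eq rewrite ≡ᵇ-true eq = refl

↦-miss : ∀ {A : Set} (f : ℕ → A) {x y v} → y ≢ x → (f [ x ↦ v ]) y ≡ f y
↦-miss f ne rewrite ≡ᵇ-false ne = refl

<ᵇ-true : ∀ {m n} → m < n → bit (m <ᵇ n) ≢ 0
<ᵇ-true {m} {n} m<n with m <ᵇ n | <⇒<ᵇ m<n
... | true | _ = λ ()

<ᵇ-false : ∀ {m n} → ¬ m < n → bit (m <ᵇ n) ≡ 0
<ᵇ-false {m} {n} m≮n with m <ᵇ n | <ᵇ⇒< m n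
... | true  | lt = contradiction (lt _) m≮n
... | false | _  = refl

<ᵇ-≢0 : ∀ {m n} → bit (m <ᵇ n) ≢ 0 → m < n
<ᵇ-≢0 {m} {n} ne with m <ᵇ n | <ᵇ⇒< m n
... | true  | lt = lt _
... | false | _  = contradiction refl ne

<ᵇ-≡0 : ∀ {m n} → bit (m <ᵇ n) ≡ 0 → ¬ m < n
<ᵇ-≡0 {m} {n} eq m<n = <ᵇ-true m<n eq

suc≢0 : ∀ {m n} → m ≡ suc n → m ≢ 0
suc≢0 refl ()

index-injective : ∀ {n} {k k′ : Fin n} → index k ≡ index k′ → k ≡ k′
index-injective eq = Fin.toℕ-injective (suc-injective eq)

-- Total correctness with time bounds

record Runs (c : Cmd) (s : Memory) (b : ℕ) (Q : Memory → Set) : Set where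
  constructor runs
  field
    {memory} : Memory
    {time}   : ℕ
    exec     : ⟨ c , s ⟩⇓[ time ] memory
    bound    : time ≤ b
    post     : Q memory

run-weaken : ∀ {c s b b′ Q} → b ≤ b′ → Runs c s b Q → Runs c s b′ Q
run-weaken b≤b′ (runs e t q) = runs e (≤-trans t b≤b′) q

run-skip : ∀ {s Q} → Q s → Runs skip s 1 Q
run-skip q = runs ⇓skip ≤-refl q

run-reg : ∀ {x e s Q} → Q ⟪ regs s [ x ↦ eval e s ] , tabs s ⟫ → Runs (x ≔ e) s (1 + cost e) Q
run-reg q = runs ⇓reg ≤-refl q

run-tab : ∀ {a e f s Q} → Q ⟪ regs s , tabs s [ a ↦ tabs s a [ eval e s ↦ eval f s ] ] ⟫ →
          Runs (a ⟨ e ⟩≔ f) s (1 + cost e + cost f) Q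
run-tab q = runs ⇓tab ≤-refl q

-- The run of the second command is the postcondition of the first. Proofs about programs thus nest
-- as continuations, and intermediate memories need not be written out.
run-seq : ∀ {c c′ s b b′ Q} → Runs c s b (λ s′ → Runs c′ s′ b′ Q) → Runs (c ⨾ c′) s (b + b′) Q
run-seq (runs e t (runs e′ t′ q)) = runs (⇓seq e e′) (+-mono-≤ t t′) q

run-test : ∀ {e c c′ s b Q} → (eval e s ≢ 0 → Runs c s b Q) → (eval e s ≡ 0 → Runs c′ s b Q) →
           Runs (test e then c else c′) s (1 + cost e + b) Q
run-test {e} {s = s} yes′ no′ with eval e s ≟ 0
... | no  ne with runs x t q ← yes′ ne = runs (⇓then ne x) (+-monoʳ-≤ (1 + cost e) t) q
... | yes eq with runs x t q ← no′ eq  = runs (⇓else eq x) (+-monoʳ-≤ (1 + cost e) t) q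

run-stop : ∀ {e c s Q} → eval e s ≡ 0 → Q s → Runs (while e loop c) s (1 + cost e) Q
run-stop eq q = runs (⇓stop eq) ≤-refl q

run-again : ∀ {e c s b b′ Q} → eval e s ≢ 0 →
            Runs c s b (λ s′ → Runs (while e loop c) s′ b′ Q) →
            Runs (while e loop c) s (1 + cost e + b + b′) Q
run-again {e} ne (runs x t (runs x′ t′ q)) =
  runs (⇓again ne x x′) (+-mono-≤ (+-monoʳ-≤ (1 + cost e) t) t′) q

run-map : ∀ {c s b Q R} → (∀ {s} → Q s → R s) → Runs c s b Q → Runs c s b R
run-map f (runs e t q) = runs e t (f q)

-- The program

cursorᴿ lastᴿ nodeᴿ childᴿ minᴿ : Reg
cursorᴿ = 4
lastᴿ   = 5
nodeᴿ   = 6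
childᴿ  = 7
minᴿ    = 8

headᵀ nextᵀ : Tab
headᵀ = 8
nextᵀ = 9

clearHead insertState clearHeads insertStates markPosition markPositions lowerMin minOverChildren
  visitNode visitLevel visitNodes visitLevels program : Cmd

-- Working memory is arbitrary at the start, so the bucket heads must be reset. The cursor starts at
-- |w| + 1 and is decremented before each write, which clears the entries |w| down to 0.
clearHead =
  cursorᴿ ≔ reg cursorᴿ ⊖ lit 1 ⨾
  headᵀ ⟨ reg cursorᴿ ⟩≔ lit 0

clearHeads = while reg cursorᴿ loop clearHead

insertState =
  -- Step 1 shares this loop with the filling of the buckets; |w| + 1 stands for +∞.
  dᵀ ⟨ reg cursorᴿ ⟩≔ reg lengthᴿ ⊕ lit 1 ⨾
  nextᵀ ⟨ reg cursorᴿ ⟩≔ headᵀ ⟨ ℓᵀ ⟨ reg cursorᴿ ⟩ ⟩ ⨾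
  headᵀ ⟨ ℓᵀ ⟨ reg cursorᴿ ⟩ ⟩≔ reg cursorᴿ ⨾
  cursorᴿ ≔ reg cursorᴿ ⊖ lit 1

insertStates = while reg cursorᴿ loop insertState

markPosition =
  test Pᵀ ⟨ reg cursorᴿ ⟩ then (lastᴿ ≔ reg cursorᴿ) else skip ⨾
  -- The value 0 stands for -∞, without ambiguity because positions start at 1.
  test reg lastᴿ
    then (dᵀ ⟨ Tᵀ ⟨ reg cursorᴿ ⟩ ⟩≔ reg cursorᴿ ⊖ reg lastᴿ)
    else (dᵀ ⟨ Tᵀ ⟨ reg cursorᴿ ⟩ ⟩≔ reg lengthᴿ ⊕ lit 1) ⨾
  -- With the literal first, the sum reduces to a successor.
  cursorᴿ ≔ lit 1 ⊕ reg cursorᴿ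

markPositions = while (reg cursorᴿ ≺ reg lengthᴿ ⊕ lit 1) loop markPosition

lowerMin =
  test (dᵀ ⟨ reg childᴿ ⟩ ≺ reg minᴿ) then (minᴿ ≔ dᵀ ⟨ reg childᴿ ⟩) else skip ⨾
  childᴿ ≔ nextSiblingᵀ ⟨ reg childᴿ ⟩

minOverChildren = while reg childᴿ loop lowerMin

visitNode =
  minᴿ ≔ dᵀ ⟨ reg nodeᴿ ⟩ ⨾
  childᴿ ≔ firstChildᵀ ⟨ reg nodeᴿ ⟩ ⨾
  minOverChildren ⨾
  dᵀ ⟨ reg nodeᴿ ⟩≔ reg minᴿ ⨾
  test (reg minᴿ ≺ ℓᵀ ⟨ reg nodeᴿ ⟩)
    then (nodeᴿ ≔ nextᵀ ⟨ reg nodeᴿ ⟩)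
    -- The early return: zeroing the registers that drive both loops makes each stop at its next
    -- test. The decrement in `visitLevel` in between leaves the cursor at 0, subtraction being
    -- truncated.
    else (answerᴿ ≔ lit 0 ⨾ nodeᴿ ≔ lit 0 ⨾ cursorᴿ ≔ lit 0)

visitNodes = while reg nodeᴿ loop visitNode

visitLevel =
  nodeᴿ ≔ headᵀ ⟨ reg cursorᴿ ⟩ ⨾
  visitNodes ⨾
  cursorᴿ ≔ reg cursorᴿ ⊖ lit 1

visitLevels = while reg cursorᴿ loop visitLevel

program =
  cursorᴿ ≔ reg lengthᴿ ⊕ lit 1 ⨾
  clearHeads ⨾
  cursorᴿ ≔ reg sizeᴿ ⨾
  insertStates ⨾
  cursorᴿ ≔ lit 1 ⨾
  lastᴿ ≔ lit 0 ⨾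
  markPositions ⨾
  answerᴿ ≔ lit 1 ⨾
  cursorᴿ ≔ reg lengthᴿ ⨾
  visitLevels

-- Memory contents and the loop invariants

linkedList-↦ : ∀ {n next p v} {q : Fin n} {qs} → LinkedList next p qs → q ∉ qs →
               LinkedList (next [ index q ↦ v ]) p qs
linkedList-↦ end _ = end
linkedList-↦ {next = next} {v = v} {q} (node {r} {rs} l) q∉ =
  node (subst (λ p → LinkedList (next [ index q ↦ v ]) p rs)
         (sym (↦-miss next (λ eq → q∉ (here (sym (index-injective eq))))))
         (linkedList-↦ l (q∉ ∘ there)))

⊓⁺-swap : ∀ x y z → x ⊓⁺ (y ⊓⁺ z) ≡ y ⊓⁺ (x ⊓⁺ z)
⊓⁺-swap ⊤⁺    ⊤⁺    z     = refl
⊓⁺-swap ⊤⁺    [ y ] z     = refl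
⊓⁺-swap [ x ] ⊤⁺    z     = refl
⊓⁺-swap [ x ] [ y ] ⊤⁺    = cong [_] (⊓-comm x y)
⊓⁺-swap [ x ] [ y ] [ z ] = cong [_] (begin
  x ⊓ (y ⊓ z)  ≡⟨ ⊓-assoc x y z ⟨
  (x ⊓ y) ⊓ z  ≡⟨ cong (_⊓ z) (⊓-comm x y) ⟩
  (y ⊓ x) ⊓ z  ≡⟨ ⊓-assoc y x z ⟩
  y ⊓ (x ⊓ z)  ∎)
  where open ≡-Reasoning

-- The loop absorbs the first child into its accumulator, while `foldr` applies it last; this
-- reconciles the two.
foldr-⊓⁺ : ∀ x a ys → foldr _⊓⁺_ (x ⊓⁺ a) ys ≡ x ⊓⁺ foldr _⊓⁺_ a ys
foldr-⊓⁺ x a []       = refl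
foldr-⊓⁺ x a (y ∷ ys) = trans (cong (y ⊓⁺_) (foldr-⊓⁺ x a ys)) (⊓⁺-swap y x _)

module _ {σ : ℕ} {w : Word {σ}} (S : SuffixAutomaton w) (P : Subset (length w)) where
  open SuffixAutomaton S

  -- The conditions are imposed on the registers and tables one by one, so that
  -- they carry over definitionally to a memory in which others have changed.
  record Known (len siz : ℕ) (pos lev pre chi sib : ℕ → ℕ) : Set where
    field
      len≡  : len ≡ length w
      siz≡  : siz ≡ size
      pos≡  : ∀ k → pos (index k) ≡ bit (Vec.lookup P k)
      lev≡  : ∀ q → lev (index q) ≡ ℓ q
      pre≡  : ∀ k → pre (index k) ≡ index (T k)
      list  : ∀ q → LinkedList sib (chi (index q)) (children q)

  Holds : Memory → Set
  Holds s = Known (regs s lengthᴿ) (regs s sizeᴿ) (tabs s Pᵀ) (tabs s ℓᵀ) (tabs s Tᵀ)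
                  (tabs s firstChildᵀ) (tabs s nextSiblingᵀ)

  input-holds : ∀ {s} → Input S P s → Holds s
  input-holds inp = record
    { len≡ = lengthIn ; siz≡ = sizeIn ; pos≡ = PIn ; lev≡ = ℓIn ; pre≡ = TIn ; list = childrenIn }
    where open Input inp

  record Buckets (qs : List State) (next head : ℕ → ℕ) : Set where
    constructor buckets
    field
      bucket : ∀ l → l ≤ length w → LinkedList next (head l) (level S l qs)

  Ready : List State → Memory → Set
  Ready qs s = Holds s × Buckets qs (tabs s nextᵀ) (tabs s headᵀ)

  -- Finite entries are bounded by |w|, beyond what `Stores` asks. Otherwise a finite entry could
  -- exceed the number chosen for +∞, and comparing stored numbers would give the wrong minimum.
  Bounded : ℕ ⁺ → ℕ → Set
  Bounded ⊤⁺    v = length w < v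
  Bounded [ m ] v = v ≡ m × m ≤ length w

  record Stored (d : Table S) (f : ℕ → ℕ) : Set where
    constructor stores
    field
      stored : ∀ q → Bounded (d q) (f (index q))

  open Buckets public
  open Stored public

  bounded-stores : ∀ x {v} → Bounded x v → Stores S x v
  bounded-stores ⊤⁺    p = p
  bounded-stores [ _ ] p = proj₁ p

  stored-↦ : ∀ {d f q x v} → Stored d f → Bounded x v →
             Stored (updateAt d q (const x)) (f [ index q ↦ v ])
  stored (stored-↦ {d} {f} {q} {x} {v} st b) r with r Fin.≟ q
  ... | yes refl = subst₂ Bounded (sym (Vector.updateAt-updates q d)) (sym (↦-hit f {index q} refl)) b
  ... | no  r≢q  = subst₂ Bounded (sym (Vector.updateAt-minimal r q d r≢q))
                     (sym (↦-miss f (r≢q ∘ index-injective))) (stored st r)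

  -- A stored +∞ exceeds |w|, so it cannot lie below a threshold `l ≤ length w`; `ℓ-bounded`
  -- supplies this bound where the test is made.
  bounded-< : ∀ x {v} l → Bounded x v → l ≤ length w → v < l → (x ≥⁺ l) ≡ false
  bounded-< x l b l≤n v<l with ≥⁺-or-<⁺ x l
  ... | inj₂ (eq , _) = eq
  bounded-< ⊤⁺    l b          l≤n v<l | inj₁ (_ , _)  = contradiction (<-≤-trans (<-trans b v<l) l≤n) (<-irrefl refl)
  bounded-< [ m ] l (refl , _) l≤n v<l | inj₁ (_ , ≮l) = contradiction v<l ≮l

  bounded-≥ : ∀ x {v} l → Bounded x v → ¬ v < l → (x ≥⁺ l) ≡ true
  bounded-≥ x l b v≮l with ≥⁺-or-<⁺ x l
  ... | inj₁ (eq , _) = eq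
  bounded-≥ [ m ] l (refl , _) v≮l | inj₂ (_ , m<l) = contradiction m<l v≮l

  bounded-⊓-< : ∀ x y {u v} → Bounded x u → Bounded y v → u < v → Bounded (x ⊓⁺ y) u
  bounded-⊓-< ⊤⁺    ⊤⁺    bx by u<v = bx
  bounded-⊓-< ⊤⁺    [ m ] bx (refl , m≤n) u<v = contradiction (<-≤-trans (<-trans bx u<v) m≤n) (<-irrefl refl)
  bounded-⊓-< [ l ] ⊤⁺    bx by u<v = bx
  bounded-⊓-< [ l ] [ m ] (refl , l≤n) (refl , m≤n) l<m =
    sym (m≤n⇒m⊓n≡m (<⇒≤ l<m)) , ≤-trans (m⊓n≤m l m) l≤n

  bounded-⊓-≥ : ∀ x y {u v} → Bounded x u → Bounded y v → ¬ u < v → Bounded (x ⊓⁺ y) v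
  bounded-⊓-≥ ⊤⁺    y     bx by u≮v = by
  bounded-⊓-≥ [ l ] ⊤⁺    (refl , l≤n) by u≮v = contradiction (≤-<-trans l≤n by) u≮v
  bounded-⊓-≥ [ l ] [ m ] (refl , l≤n) (refl , m≤n) l≮m =
    sym (m≥n⇒m⊓n≡n (≮⇒≥ l≮m)) , ≤-trans (m⊓n≤m l m) l≤n

  Cleared : (ℕ → ℕ) → ℕ → Set
  Cleared head m = ∀ l → m ≤ l → l ≤ length w → head l ≡ 0

  cleared-step : ∀ {head m x} → x ≡ m → Cleared head (suc m) → Cleared (head [ x ↦ 0 ]) m
  cleared-step {head} {m} refl cleared l m≤l l≤n with l ≟ m
  ... | yes l≡m = ↦-hit head l≡m
  ... | no  l≢m = trans (↦-miss head l≢m) (cleared l (≤∧≢⇒< m≤l (l≢m ∘ sym)) l≤n)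

  -- In the time bounds m * c + c₀ of loops, c is the time of one round, including
  -- its test, and c₀ that of the last test.
  run-clearHeads : ∀ m s → Holds s → regs s cursorᴿ ≡ m → Cleared (tabs s headᵀ) m →
    Runs clearHeads s (m * 9 + 2) (λ s′ → Holds s′ × Cleared (tabs s′ headᵀ) 0)
  run-clearHeads zero    s h c≡ cleared = run-stop c≡ (h , cleared)
  run-clearHeads (suc m) s h c≡ cleared = run-again (suc≢0 c≡)
    (run-seq (run-reg (run-tab
      (run-clearHeads m _ h (cong pred c≡) (cleared-step (cong pred c≡) cleared)))))

  -- Pushing q in front of its bucket mirrors `filter` on `q ∷ qs`. The write to the pointer of q
  -- disturbs no bucket, since q is in none of them yet.
  buckets-insert : ∀ {qs next head q x y} → x ≡ index q → y ≡ ℓ q → q ∉ qs → Buckets qs next head →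
    Buckets (q ∷ qs) (next [ x ↦ head y ]) (head [ y ↦ x ])
  buckets-insert {qs} {next} {head} {q} refl refl q∉ bs = buckets λ l l≤n → helper l l≤n (ℓ q ≟ l)
    where
    next′ = next [ index q ↦ head (ℓ q) ]
    head′ = head [ ℓ q ↦ index q ]

    preserved : ∀ l → l ≤ length w → LinkedList next′ (head l) (level S l qs)
    preserved l l≤n = linkedList-↦ (bucket bs l l≤n) (q∉ ∘ proj₁ ∘ Mem.∈-filter⁻ (λ q → ℓ q ≟ l))

    helper : ∀ l → l ≤ length w → _ → LinkedList next′ (head′ l) (level S l (q ∷ qs))
    helper _ l≤n (yes refl) = subst₂ (LinkedList next′)
      (sym (↦-hit head {ℓ q} refl)) (sym (filter-accept (λ r → ℓ r ≟ ℓ q) refl))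
      (node (subst (λ p → LinkedList next′ p (level S (ℓ q) qs)) (sym (↦-hit next {index q} refl))
        (preserved (ℓ q) l≤n)))
    helper l l≤n (no ne) = subst₂ (LinkedList next′)
      (sym (↦-miss head (ne ∘ sym))) (sym (filter-reject (λ r → ℓ r ≟ l) ne)) (preserved l l≤n)

  record Inserted (m : ℕ) (qs : List State) (d next head : ℕ → ℕ) : Set where
    field
      unique  : Unique qs
      above   : ∀ (q : State) → q ∈ qs ⇔ m < index q
      infinite : ∀ (q : State) → m < index q → length w < d (index q)
      linked  : Buckets qs next head

  inserted-step : ∀ {m qs d next head} q {x y v} → index q ≡ suc m → x ≡ index q → y ≡ ℓ q → length w < v →
    Inserted (suc m) qs d next head →
    Inserted m (q ∷ qs) (d [ x ↦ v ]) (next [ x ↦ head y ]) (head [ y ↦ x ])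
  inserted-step {m} {qs} {d} q refl refl refl n<v ins = record
    { unique   = All.tabulate (λ { r∈ refl → q∉ r∈ }) ∷ unique
    ; above    = λ r → mk⇔
        (λ { (here refl) → ≤-refl ; (there r∈) → <⇒≤ (to (above r) r∈) })
        (λ m<r → case r Fin.≟ q of λ
          { (yes refl) → here refl
          ; (no r≢q) → there (from (above r) (≤∧≢⇒< m<r (r≢q ∘ sym ∘ index-injective))) })
    ; infinite = inf
    ; linked   = buckets-insert refl refl q∉ linked
    }
    where
    open Inserted ins
    q∉ : q ∉ qs
    q∉ q∈ = <-irrefl refl (to (above q) q∈)

    inf : ∀ r → m < index r → length w < (d [ index q ↦ _ ]) (index r)
    inf r m<r with r Fin.≟ q
    ... | yes refl = subst (length w <_) (sym (↦-hit d {index q} refl)) n<v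
    ... | no r≢q   = subst (length w <_) (sym (↦-miss d (r≢q ∘ index-injective)))
      (infinite r (≤∧≢⇒< m<r (r≢q ∘ sym ∘ index-injective)))

  run-insertStates : ∀ m s qs → m ≤ size → Holds s → regs s cursorᴿ ≡ m →
    Inserted m qs (tabs s dᵀ) (tabs s nextᵀ) (tabs s headᵀ) →
    Runs insertStates s (m * 20 + 2) (λ s′ → ∃[ qs′ ]
      (Ready qs′ s′ × Unique qs′ × (∀ q → q ∈ qs′) × Stored (step1 S) (tabs s′ dᵀ)))
  run-insertStates zero    s qs m≤ h c≡ ins = run-stop c≡
    (qs , (h , linked) , unique , (λ q → from (above q) (s≤s z≤n)) , stores λ q → infinite q (s≤s z≤n))
    where open Inserted ins
  run-insertStates (suc m) s qs m< h c≡ ins with q , q≡ ← position m< = run-again (suc≢0 c≡)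
    (run-seq (run-tab (run-seq (run-tab (run-seq (run-tab (run-reg
      (run-insertStates m _ (q ∷ qs) (<⇒≤ m<) h (cong pred c≡)
        (inserted-step q q≡ c≡q (trans (cong (tabs s ℓᵀ) c≡q) (lev≡ q))
          (subst (λ l → length w < l + 1) (sym len≡) (m<m+n (length w) (s≤s z≤n))) ins)))))))))
    where
    open Known h
    c≡q = trans c≡ (sym q≡)

  Points : ℕ ₋ → ℕ → Set
  Points ⊥₋    v = v ≡ 0
  Points [ k ] v = v ≡ k × v ≢ 0

  points-latest : ∀ j {κ v} → Points κ v → Vec.lookup P j ≡ false → Points (latest P j κ) v
  points-latest j pts eq rewrite eq = pts

  points-latest′ : ∀ (j : Fin (length w)) {κ v} → v ≡ index j → Vec.lookup P j ≡ true → Points (latest P j κ) v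
  points-latest′ j refl eq rewrite eq = refl , λ ()

  bounded-⊝ : ∀ (j : Fin (length w)) {κ v} → Points κ v → v ≢ 0 → Bounded (index j ⊝ κ) (index j ∸ v)
  bounded-⊝ j {⊥₋}    v≡0        v≢0 = contradiction v≡0 v≢0
  bounded-⊝ j {[ k ]} (refl , _) _   = refl , ≤-trans (m∸n≤m (index j) k) (Fin.toℕ<n j)

  bounded-⊝-∞ : ∀ (j : Fin (length w)) {κ v u} → Points κ v → v ≡ 0 → length w < u → Bounded (index j ⊝ κ) u
  bounded-⊝-∞ j {⊥₋}    _         _   n<u = n<u
  bounded-⊝-∞ j {[ k ]} (_ , v≢0) v≡0 _   = contradiction v≡0 v≢0

  bit-≢0 : ∀ {b} → bit b ≢ 0 → b ≡ true
  bit-≢0 {true}  _  = refl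
  bit-≢0 {false} ne = contradiction refl ne

  bit-≡0 : ∀ {b} → bit b ≡ 0 → b ≡ false
  bit-≡0 {false} _ = refl

  Marking : List State → Fin (length w) → ℕ ₋ → Table S → Memory → Set
  Marking qs j κ d s = Ready qs s × regs s cursorᴿ ≡ index j × Points κ (regs s lastᴿ) × Stored d (tabs s dᵀ)

  run-markPosition : ∀ {qs} j s d κ → Marking qs j κ d s →
    let d′ , κ′ = visit S P (d , κ) j in
    Runs markPosition s 17 (λ s′ → Ready qs s′ × regs s′ cursorᴿ ≡ suc (index j) ×
                                  Points κ′ (regs s′ lastᴿ) × Stored d′ (tabs s′ dᵀ))
  run-markPosition {qs} j s d κ (ready@(h , _) , c≡ , pts , st) =
    run-seq (run-map mark (run-test
      (λ ne → run-reg (ready , c≡ , points-latest′ j c≡ (bit-≢0 (subst (_≢ 0) Pj ne)) , st))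
      (λ eq → run-weaken (s≤s z≤n) (run-skip
        (ready , c≡ , points-latest j pts (bit-≡0 (trans (sym Pj) eq)) , st)))))
    where
    Pj : tabs s Pᵀ (regs s cursorᴿ) ≡ bit (Vec.lookup P j)
    Pj = trans (cong (tabs s Pᵀ) c≡) (Known.pos≡ h j)

    mark : ∀ {s′} → Marking qs j (latest P j κ) d s′ → Runs _ s′ _ _
    mark {s′} (ready@(h , _) , c≡ , pts , st) = run-seq (run-test
      (λ ne → run-tab (run-reg (ready , cong suc c≡ , pts , write
        (subst (λ i → Bounded _ (i ∸ regs s′ lastᴿ)) (sym c≡) (bounded-⊝ j pts ne)))))
      (λ eq → run-tab (run-reg (ready , cong suc c≡ , pts , write (bounded-⊝-∞ j pts eq
        (subst (λ l → length w < l + 1) (sym (Known.len≡ h)) (m<m+n (length w) (s≤s z≤n))))))))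
      where
      write : ∀ {v} → Bounded (index j ⊝ latest P j κ) v →
              Stored (updateAt d (T j) (const (index j ⊝ latest P j κ)))
                         (tabs s′ dᵀ [ tabs s′ Tᵀ (regs s′ cursorᴿ) ↦ v ])
      write {v} b = subst (λ i → Stored _ (tabs s′ dᵀ [ i ↦ v ]))
        (sym (trans (cong (tabs s′ Tᵀ) c≡) (Known.pre≡ h j))) (stored-↦ st b)

  run-markPositions : ∀ {qs i js} → Ascending i js → ∀ s d κ → Ready qs s →
    regs s cursorᴿ ≡ suc i → Points κ (regs s lastᴿ) → Stored d (tabs s dᵀ) →
    Runs markPositions s (length js * 23 + 6) (λ s′ → Ready qs s′ ×
      Stored (proj₁ (foldl (visit S P) (d , κ) js)) (tabs s′ dᵀ))
  run-markPositions done s d κ ready@(h , _) c≡ pts st = run-stop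
    (<ᵇ-false (λ lt → <-irrefl refl (subst₂ _<_ c≡ (trans (cong (_+ 1) (Known.len≡ h)) (+-comm (length w) 1)) lt)))
    (ready , st)
  run-markPositions (step {j} asc) s d κ ready@(h , _) c≡ pts st = run-again
    (<ᵇ-true (subst₂ _<_ (sym c≡) (sym (trans (cong (_+ 1) (Known.len≡ h)) (+-comm (length w) 1)))
      (s≤s (Fin.toℕ<n j))))
    (run-map (λ (ready , c≡ , pts , st) → run-markPositions asc _ _ _ ready c≡ pts st)
      (run-markPosition j s d κ (ready , c≡ , pts , st)))

  run-step2 : ∀ {qs} s → Ready qs s → regs s cursorᴿ ≡ 1 → regs s lastᴿ ≡ 0 →
    Stored (step1 S) (tabs s dᵀ) →
    Runs markPositions s (length w * 23 + 6)
      (λ s′ → Ready qs s′ × Stored (step2 S P (step1 S)) (tabs s′ dᵀ))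
  run-step2 {qs} s ready c≡ l≡ st = subst
    (λ m → Runs markPositions s (m * 23 + 6)
      (λ s′ → Ready qs s′ × Stored (step2 S P (step1 S)) (tabs s′ dᵀ)))
    (length-tabulate {n = length w} (λ k → k))
    (run-markPositions (allFin-ascending (length w)) s (step1 S) ⊥₋ ready c≡ l≡ st)

  -- The last four conditions are a frame: they keep what the inner loop leaves alone and the rest
  -- of `visitNode` relies on.
  Minimizing : List State → Table S → (ℕ → ℕ) → (ans cur nod : ℕ) → ℕ ⁺ → Memory → Set
  Minimizing qs d nx ans cur nod a s =
    Ready qs s × Stored d (tabs s dᵀ) × Bounded a (regs s minᴿ) × tabs s nextᵀ ≡ nx ×
    regs s answerᴿ ≡ ans × regs s cursorᴿ ≡ cur × regs s nodeᴿ ≡ nod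

  run-minOverChildren : ∀ {qs d nx ans cur nod rs p} a s → LinkedList (tabs s nextSiblingᵀ) p rs →
    regs s childᴿ ≡ p → Minimizing qs d nx ans cur nod a s →
    Runs minOverChildren s (length rs * 13 + 2) (Minimizing qs d nx ans cur nod (foldr _⊓⁺_ a (map d rs)))
  run-minOverChildren a s end c≡ inv = run-stop c≡ inv
  run-minOverChildren {qs} {d} {nx} {ans} {cur} {nod} a s (node {r} {rs} rest) c≡ (ready , st , bnd , frame) =
    run-again (suc≢0 c≡) (run-seq (run-test
      (λ lt → run-reg (run-reg (continue rest next≡
        (ready , st , bounded-⊓-< (d r) a dr bnd (<ᵇ-≢0 lt) , frame))))
      (λ ge → run-weaken (s≤s z≤n) (run-skip (run-reg (continue rest next≡
        (ready , st , bounded-⊓-≥ (d r) a dr bnd (<ᵇ-≡0 ge) , frame)))))))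
    where
    dr : Bounded (d r) (tabs s dᵀ (regs s childᴿ))
    dr = subst (λ i → Bounded (d r) (tabs s dᵀ i)) (sym c≡) (stored st r)

    next≡ : tabs s nextSiblingᵀ (regs s childᴿ) ≡ tabs s nextSiblingᵀ (index r)
    next≡ = cong (tabs s nextSiblingᵀ) c≡

    continue : ∀ {s′ p} → LinkedList (tabs s′ nextSiblingᵀ) p rs → regs s′ childᴿ ≡ p →
      Minimizing qs d nx ans cur nod (d r ⊓⁺ a) s′ →
      Runs minOverChildren s′ (length rs * 13 + 2)
        (Minimizing qs d nx ans cur nod (d r ⊓⁺ foldr _⊓⁺_ a (map d rs)))
    continue {s′} rest c≡ inv = subst
      (λ x → Runs minOverChildren s′ (length rs * 13 + 2) (Minimizing qs d nx ans cur nod x))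
      (foldr-⊓⁺ (d r) a (map d rs)) (run-minOverChildren (d r ⊓⁺ a) s′ rest c≡ inv)

  -- The time of a visit with its loop test: 13 for each child, and 24 = 2 + 3 + 3 + 2 + 14 for the
  -- test, the two initial assignments, the last test over the children, and what follows.
  work : State → ℕ
  work q = length (children q) * 13 + 24

  Visiting : List State → Table S → (ans cur : ℕ) → Memory → Set
  Visiting qs d ans cur s =
    Ready qs s × Stored d (tabs s dᵀ) × regs s answerᴿ ≡ ans × regs s cursorᴿ ≡ cur

  -- A bucket ends either in the early return, visible as answer and cursor 0, or with `rest` still
  -- to be processed. The outcome of the whole remaining traversal is a parameter, so both cases
  -- speak about the same final result.
  Visited : List State → Bool × Table S → (rest : List State) → ℕ → Memory → Set
  Visited qs outcome rest cur s = ∃[ d ]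
    ( outcome ≡ (false , d)    × Visiting qs d 0 0 s
    ⊎ outcome ≡ step3 S rest d × Visiting qs d 1 cur s )

  module _ (q : State) (qs : List State) (d : Table S) where

    minimum : ℕ ⁺
    minimum = foldr _⊓⁺_ (d q) (map d (children q))

    step3-stop : (minimum ≥⁺ ℓ q) ≡ true → step3 S (q ∷ qs) d ≡ (false , updateAt d q (const minimum))
    step3-stop eq rewrite eq = refl

    step3-continue : (minimum ≥⁺ ℓ q) ≡ false →
                     step3 S (q ∷ qs) d ≡ step3 S qs (updateAt d q (const minimum))
    step3-continue eq rewrite eq = refl

  run-visitNodes : ∀ {qs b p cur} s d rest → LinkedList (tabs s nextᵀ) p b → regs s nodeᴿ ≡ p →
    Visiting qs d 1 cur s → Runs visitNodes s (sum (map work b) + 2) (Visited qs (step3 S (b ++ rest) d) rest cur)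
  run-visitNodes s d rest end c≡ inv = run-stop c≡ (d , inj₂ (refl , inv))
  run-visitNodes {qs} {cur = cur} s d rest (node {q} {b} l) c≡ (ready , st , a≡ , cur≡) =
    run-weaken (≤-reflexive (arrange (length (children q) * 13) (sum (map work b))))
      (run-again (suc≢0 c≡) (run-seq (run-reg (run-seq (run-reg (run-seq (run-map after
        (run-minOverChildren (d q) _ (Known.list (proj₁ ready) q) (cong (tabs s firstChildᵀ) c≡)
          (ready , st , subst (λ i → Bounded (d q) (tabs s dᵀ i)) (sym c≡) (stored st q)
          , refl , a≡ , cur≡ , c≡)))))))))
    where
    arrange : ∀ x y → 2 + (3 + (3 + ((x + 2) + 14))) + (y + 2) ≡ x + 24 + y + 2
    arrange = solve-∀

    m : ℕ ⁺
    m = minimum q (b ++ rest) d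
    d′ : Table S
    d′ = updateAt d q (const m)

    after : ∀ {s′} → Minimizing qs d (tabs s nextᵀ) 1 cur (index q) m s′ → Runs _ s′ 14
      (λ s″ → Runs visitNodes s″ (sum (map work b) + 2) (Visited qs (step3 S (q ∷ b ++ rest) d) rest cur))
    after {s′} (ready@(h , _) , st , bnd , nx≡ , a≡ , cur≡ , nod≡) = run-seq (run-tab (run-test
      (λ lt → run-weaken (s≤s (s≤s (s≤s z≤n))) (run-reg (subst
        (λ o → Runs visitNodes _ (sum (map work b) + 2) (Visited qs o rest cur))
        (sym (step3-continue q (b ++ rest) d (bounded-< m (ℓ q) bnd (ℓ-bounded S q)
          (subst (regs s′ minᴿ <_) ℓ≡ (<ᵇ-≢0 lt)))))
        (run-visitNodes _ d′ rest (subst (λ nx → LinkedList nx _ b) (sym nx≡) l)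
          (cong₂ (λ nx i → nx i) nx≡ nod≡) (ready , st′ , a≡ , cur≡)))))
      (λ ge → run-seq (run-reg (run-seq (run-reg (run-reg (run-weaken (m≤n+m 2 (sum (map work b)))
        (run-stop refl (d′ , inj₁
          ( step3-stop q (b ++ rest) d (bounded-≥ m (ℓ q) bnd (<ᵇ-≡0 ge ∘ subst (regs s′ minᴿ <_) (sym ℓ≡)))
          , ready , st′ , refl , refl)))))))))))
      where
      ℓ≡ : tabs s′ ℓᵀ (regs s′ nodeᴿ) ≡ ℓ q
      ℓ≡ = trans (cong (tabs s′ ℓᵀ) nod≡) (Known.lev≡ h q)
      st′ : Stored d′ (tabs s′ dᵀ [ regs s′ nodeᴿ ↦ regs s′ minᴿ ])
      st′ = subst (λ i → Stored d′ (tabs s′ dᵀ [ i ↦ regs s′ minᴿ ])) (sym nod≡) (stored-↦ st bnd)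

  bounded-output : ∀ {b} d {s} → regs s answerᴿ ≡ bit b → Stored d (tabs s dᵀ) → Output S (b , d) s
  bounded-output d a≡ st = record { answerOut = a≡ ; dOut = λ q → bounded-stores (d q) (stored st q) }

  -- Even an empty level costs 11 = 2 + 3 + 2 + 4: the loop test, reading the head, the last test of
  -- the inner loop, and the decrement.
  run-visitLevels : ∀ {qs} l s d → l ≤ length w → Visiting qs d 1 l s →
    Runs visitLevels s (l * 11 + sum (map work (byLevel S qs l)) + 2) (Output S (step3 S (byLevel S qs l) d))
  run-visitLevels zero    s d l≤n (ready , st , a≡ , cur≡) = run-stop cur≡ (bounded-output d a≡ st)
  run-visitLevels {qs} (suc l) s d l<n (ready@(h , bs) , st , a≡ , cur≡) =
    run-weaken (≤-reflexive total)
      (run-again (suc≢0 cur≡) (run-seq (run-reg (run-seq (run-map after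
        (run-visitNodes _ d (byLevel S qs l) (bucket bs (suc l) l<n) (cong (tabs s headᵀ) cur≡)
          (ready , st , a≡ , cur≡)))))))
    where
    this = sum (map work (level S (suc l) qs))
    below = sum (map work (byLevel S qs l))

    total : 2 + (3 + ((this + 2) + 4)) + (l * 11 + below + 2) ≡
            suc l * 11 + sum (map work (byLevel S qs (suc l))) + 2
    total = trans (arrange this (l * 11) below) (cong (λ x → suc l * 11 + x + 2) (sym (trans
      (cong sum (map-++ work (level S (suc l) qs) (byLevel S qs l)))
      (sum-++ (map work (level S (suc l) qs)) (map work (byLevel S qs l))))))
      where
      arrange : ∀ x y z → 2 + (3 + ((x + 2) + 4)) + (y + z + 2) ≡ 11 + y + (x + z) + 2
      arrange = solve-∀

    after : ∀ {s′} → Visited qs (step3 S (byLevel S qs (suc l)) d) (byLevel S qs l) (suc l) s′ →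
            Runs _ s′ 4 (λ s″ → Runs visitLevels s″ (l * 11 + below + 2)
                           (Output S (step3 S (byLevel S qs (suc l)) d)))
    after {s′} (d′ , inj₁ (eq , ready , st , a≡ , cur≡)) = run-reg (run-weaken (m≤n+m 2 (l * 11 + below))
      (run-stop (cong pred cur≡) (subst (λ o → Output S o _) (sym eq) (bounded-output d′ a≡ st))))
    after {s′} (d′ , inj₂ (eq , ready , st , a≡ , cur≡)) = run-reg (subst
      (λ o → Runs visitLevels _ (l * 11 + below + 2) (Output S o)) (sym eq)
      (run-visitLevels l _ d′ (<⇒≤ l<n) (ready , st , a≡ , cong pred cur≡)))

  -- The total running time

  sum-work : ∀ qs → sum (map work qs) ≡ length (concatMap children qs) * 13 + length qs * 24
  sum-work []       = refl
  sum-work (q ∷ qs) = begin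
    x * 13 + 24 + sum (map work qs)      ≡⟨ cong (x * 13 + 24 +_) (sum-work qs) ⟩
    x * 13 + 24 + (y * 13 + z * 24)      ≡⟨ arrange x y z ⟩
    (x + y) * 13 + suc z * 24            ≡⟨ cong (λ v → v * 13 + suc z * 24) (length-++ (children q)) ⟨
    length (concatMap children (q ∷ qs)) * 13 + suc z * 24  ∎
    where
    open ≡-Reasoning
    x = length (children q)
    y = length (concatMap children qs)
    z = length qs
    arrange : ∀ x y z → x * 13 + 24 + (y * 13 + z * 24) ≡ (x + y) * 13 + suc z * 24
    arrange = solve-∀

  -- Each state is counted at most once as a node, for 24, and at most once as a child, for 13.
  sum-work-≤ : ∀ {qs} → Unique qs → sum (map work qs) ≤ size * 37
  sum-work-≤ {qs} uniq = begin
    sum (map work qs)                                        ≡⟨ sum-work qs ⟩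
    length (concatMap children qs) * 13 + length qs * 24     ≤⟨ +-mono-≤
      (*-monoˡ-≤ 13 (unique-Fin-length (concatMap-children-unique S uniq)))
      (*-monoˡ-≤ 24 (unique-Fin-length uniq)) ⟩
    size * 13 + size * 24                                    ≡⟨ *-distribˡ-+ size 13 24 ⟨
    size * 37                                                ∎
    where open ≤-Reasoning

  Answered : Memory → Set
  Answered s = ∃[ order ] (BottomUp S order × Output S (isAttractor S P order) s)

  -- One summand for each command of program, in their order.
  programTime : ℕ → ℕ → ℕ
  programTime n m =
    4 + ((suc n * 9 + 2) + (2 + ((m * 20 + 2) + (2 + (2 + ((n * 23 + 6) + (2 + (2 + (n * 11 + m * 37 + 2)))))))))

  run-program : ∀ s → Input S P s → Runs program s (programTime (length w) size) Answered
  run-program s inp = run-seq (run-reg (run-seq (run-map cleared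
      (run-clearHeads (suc (length w)) _ h (trans (cong (_+ 1) len≡) (+-comm (length w) 1))
        (λ l n<l l≤n → contradiction (≤-trans n<l l≤n) (<-irrefl refl))))))
    where
    h = input-holds inp
    open Known h

    inserted : ∀ {s} → ∃[ qs ] (Ready qs s × Unique qs × (∀ q → q ∈ qs) × Stored (step1 S) (tabs s dᵀ)) →
      Runs _ s _ Answered
    inserted {s} (qs , ready , uniq , complete , st) = run-seq (run-reg (run-seq (run-reg (run-seq (run-map marked
      (run-step2 _ ready refl refl st))))))
      where
      marked : ∀ {s} → Ready qs s × Stored (step2 S P (step1 S)) (tabs s dᵀ) → Runs _ s _ Answered
      marked (ready@(h , _) , st) = run-seq (run-reg (run-seq (run-reg (run-weaken
        (+-monoˡ-≤ 2 (+-monoʳ-≤ (length w * 11) (sum-work-≤ (byLevel-unique S (length w) uniq))))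
        (run-map (λ out → byLevel S qs (length w) , byLevel-bottomUp S uniq complete , out)
          (run-visitLevels {qs} (length w) _ _ ≤-refl (ready , st , refl , Known.len≡ h)))))))

    cleared : ∀ {s} → Holds s × Cleared (tabs s headᵀ) 0 → Runs _ s _ Answered
    cleared {s} (h , clr) = run-seq (run-reg (run-seq (run-map inserted
      (run-insertStates size _ [] ≤-refl h (Known.siz≡ h) (record
        { unique   = []
        ; above    = λ q → mk⇔ (λ ()) (λ q≥ → contradiction (<-≤-trans q≥ (Fin.toℕ<n q)) (<-irrefl refl))
        ; infinite = λ q q≥ → contradiction (<-≤-trans q≥ (Fin.toℕ<n q)) (<-irrefl refl)
        ; linked   = buckets λ l l≤n → subst (λ p → LinkedList (tabs s nextᵀ) p []) (sym (clr l z≤n l≤n)) end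
        })))))

  -- With n = |w| and m states the time is 43n + 57m + 35. Since m is at most 2n + 2, this is at
  -- most 157n + 149, hence at most 306n once n is positive. For the empty word the time is still
  -- positive, and no multiple of 0 bounds it.
  programTime-linear : 0 < length w → programTime (length w) size ≤ 306 * length w
  programTime-linear n>0 = linear (length w) n>0 (size-bound S)
    where
    linear : ∀ n {m} → 0 < n → m ≤ 2 * suc n → programTime n m ≤ 306 * n
    linear (suc n) {m} _ m≤ = begin
      programTime (suc n) m                      ≡⟨ collect n m ⟩
      m * 57 + (n * 43 + 78)                     ≤⟨ +-monoˡ-≤ (n * 43 + 78) (*-monoˡ-≤ 57 m≤) ⟩
      2 * suc (suc n) * 57 + (n * 43 + 78)       ≤⟨ m≤m+n _ (n * 149) ⟩
      2 * suc (suc n) * 57 + (n * 43 + 78) + n * 149  ≡⟨ total n ⟩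
      306 * suc n                                ∎
      where
      open ≤-Reasoning
      collect : ∀ n m →
        4 + ((suc (suc n) * 9 + 2) + (2 + ((m * 20 + 2) + (2 + (2 + ((suc n * 23 + 6) + (2 + (2 + (suc n * 11 + m * 37 + 2)))))))))
        ≡ m * 57 + (n * 43 + 78)
      collect = solve-∀
      total : ∀ n → 2 * suc (suc n) * 57 + (n * 43 + 78) + n * 149 ≡ 306 * suc n
      total = solve-∀

proposition4 : ∃[ prog ] ∃[ C ]
    ((σ : ℕ) (w : Word {σ}) (P : Subset (length w)) (S : SuffixAutomaton w) →
    (∀ order → BottomUp S order →
    (proj₁ (isAttractor S P order) ≡ true) ⇔ WordAttractor w P)
    ×
    (∀ s → Input S P s →
    ∃[ order ] ∃[ s′ ] ∃[ t ]
    ( BottomUp S order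
    × ⟨ prog , s ⟩⇓[ t ] s′
    × Output S (isAttractor S P order) s′
    × (0 < length w → t ≤ C * length w) )))
proposition4 = program , 306 , λ σ w P S →
  (λ order → isAttractor-correct S P) , λ s inp →
    let runs exec bound (order , bottomUp , output) = run-program S P s inp
    in  order , _ , _ , bottomUp , exec , output , λ n>0 → ≤-trans bound (programTime-linear S P n>0)
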